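{- Let $\lambda=(\lambda_1,\dots,\lambda_k)$ be a composition of $n$ and $S_\lambda=S_{\lambda_1}\times\cdots\times S_{\lambda_k}\subseteq S_n$ the corresponding Young subgroup. Then the quotient complex $\Delta(\Pi_n)/S_\lambda$ is partitionable.
   Context: $\Pi_n$ is the lattice of set partitions of $\{1,\dots,n\}$ ordered by refinement, with minimum $\hat 0$ and maximum $\hat 1$. Its order complex $\Delta(\Pi_n)$ has a face for each chain $\hat 0<u_0<\dots<u_m<\hat 1$ of elements of the proper part. $S_n$ acts on $\Pi_n$ by permuting $\{1,\dots,n\}$, and hence on faces of $\Delta(\Pi_n)$; for a subgroup $G$, the quotient complex $\Delta(\Pi_n)/G$ is the boolean cell complex whose cells are the $G$-orbits of faces (chains), ordered by: an orbit $O'$ lies below an orbit $O$ if some chain in $O'$ is a subchain of some chain in $O$; its facets are the orbits of maximal chains, and the faces below a facet form a boolean lattice. Such a complex is partitionable if its set of faces can be written as a disjoint union $[G_1,F_1]\cup\cdots\cup[G_m,F_m]$ where $F_1,\dots,F_m$ are all the facets, each $G_t$ is a face of $F_t$, and $[G_t,F_t]$ denotes the set of faces $G$ with $G_t\le G\le F_t$. -}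

module Defs where

open import Data.Nat using (ℕ; zero; suc; _<_; _<ᵇ_; _∸_)
open import Data.Bool using (Bool; true; false; if_then_else_)
open import Data.Fin using (Fin; toℕ; _≟_)
open import Data.Fin.Permutation using (Permutation′; _⟨$⟩ʳ_)
open import Data.List using (List; []; _∷_)
open import Data.Nat.ListAction using (sum)
open import Data.List.Relation.Unary.All using (All)
open import Data.List.Relation.Unary.Linked using (Linked)
open import Data.List.Relation.Binary.Pointwise using (Pointwise)
open import Data.List.Relation.Binary.Sublist.Heterogeneous using (Sublist)
open import Data.Product using (Σ; _×_; _,_; ∃; ∃-syntax)
open import Relation.Nullary using (¬_; yes; no)
open import Relation.Nullary.Decidable using (⌊_⌋)
open import Relation.Binary.PropositionalEquality using (_≡_; refl; sym; trans)

-- Set partitions of {1,…,n} (here: Fin n), given by their (decidable)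
-- "same block" equivalence relation.

record Partition (n : ℕ) : Set where
  field
    rel      : Fin n → Fin n → Bool
    relRefl  : ∀ i → rel i i ≡ true
    relSym   : ∀ i j → rel i j ≡ true → rel j i ≡ true
    relTrans : ∀ i j k → rel i j ≡ true → rel j k ≡ true → rel i k ≡ true
open Partition public

module _ {n : ℕ} where

  _≤P_ : Partition n → Partition n → Set
  u ≤P v = ∀ i j → rel u i j ≡ true → rel v i j ≡ true

  _<P_ : Partition n → Partition n → Set
  u <P v = u ≤P v × ¬ (v ≤P u)

  _≈P_ : Partition n → Partition n → Set
  u ≈P v = u ≤P v × v ≤P u

private
  eqb : ∀ {n} → Fin n → Fin n → Bool
  eqb i j = ⌊ i ≟ j ⌋

  eqb-refl : ∀ {n} (i : Fin n) → eqb i i ≡ true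
  eqb-refl i with i ≟ i
  ... | yes _ = refl
  ... | no ¬p = Data.Empty.⊥-elim (¬p refl)
    where import Data.Empty

  eqb-sound : ∀ {n} (i j : Fin n) → eqb i j ≡ true → i ≡ j
  eqb-sound i j e with i ≟ j
  ... | yes p = p
  eqb-sound i j () | no _

0̂ : ∀ {n} → Partition n
0̂ = record
  { rel = eqb
  ; relRefl = eqb-refl
  ; relSym = λ i j e → helper (eqb-sound i j e)
  ; relTrans = λ i j k e f → helper2 (eqb-sound i j e) (eqb-sound j k f)
  }
  where
  helper : ∀ {i j} → i ≡ j → eqb j i ≡ true
  helper {i} refl = eqb-refl i
  helper2 : ∀ {i j k} → i ≡ j → j ≡ k → eqb i k ≡ true
  helper2 {i} refl refl = eqb-refl i

1̂ : ∀ {n} → Partition n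
1̂ = record
  { rel = λ _ _ → true
  ; relRefl = λ _ → refl
  ; relSym = λ _ _ _ → refl
  ; relTrans = λ _ _ _ _ _ → refl
  }

-- Faces of the order complex Δ(Π_n): chains  0̂ < u₀ < … < u_m < 1̂
-- of elements of the proper part, listed increasingly (the empty list
-- is the empty face).

module _ {n : ℕ} where

  IsProper : Partition n → Set
  IsProper u = (0̂ <P u) × (u <P 1̂)

  IsChain : List (Partition n) → Set
  IsChain c = All IsProper c × Linked _<P_ c

  _⊑_ : List (Partition n) → List (Partition n) → Set
  c ⊑ d = Sublist _≈P_ c d

  IsMaximalChain : List (Partition n) → Set
  IsMaximalChain c = IsChain c × (∀ d → IsChain d → c ⊑ d → d ⊑ c)

  Sends : Permutation′ n → Partition n → Partition n → Set
  Sends σ u v = ∀ i j → rel v (σ ⟨$⟩ʳ i) (σ ⟨$⟩ʳ j) ≡ rel u i j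

-- Quotient complex Δ(Π_n)/G for a subgroup G ⊆ S_n, given by its
-- membership predicate.  Cells are G-orbits of chains.

module Quotient {n : ℕ} (G : Permutation′ n → Set) where

  OrbEq : List (Partition n) → List (Partition n) → Set
  OrbEq c d = ∃[ σ ] (G σ × Pointwise (Sends σ) c d)

  -- orbit of c lies below orbit of d: some chain in the orbit of c
  -- is a subchain of some chain in the orbit of d
  -- (equivalently σ·c ⊑ d for some σ ∈ G)
  OrbLe : List (Partition n) → List (Partition n) → Set
  OrbLe c d = ∃[ σ ] (G σ × Sublist (Sends σ) c d)

  InInterval : List (Partition n) → List (Partition n) → List (Partition n) → Set
  InInterval g f x = OrbLe g x × OrbLe x f

  record Partitionable : Set where
    field
      m        : ℕ
      F        : Fin m → List (Partition n)
      Gf       : Fin m → List (Partition n)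
      F-max    : ∀ t → IsMaximalChain (F t)
      F-all    : ∀ c → IsMaximalChain c → ∃[ t ] OrbEq c (F t)
      F-distinct : ∀ t t' → OrbEq (F t) (F t') → t ≡ t'
      G-face   : ∀ t → IsChain (Gf t)
      G≤F      : ∀ t → OrbLe (Gf t) (F t)
      cover    : ∀ x → IsChain x → ∃[ t ] InInterval (Gf t) (F t) x
      disjoint : ∀ x → IsChain x → ∀ t t' →
                 InInterval (Gf t) (F t) x → InInterval (Gf t') (F t') x → t ≡ t'

IsComposition : ℕ → List ℕ → Set
IsComposition n λs = All (λ a → 0 < a) λs × sum λs ≡ n

blockOf : List ℕ → ℕ → ℕ
blockOf [] i = 0
blockOf (a ∷ as) i = if i <ᵇ a then 0 else suc (blockOf as (i ∸ a))

InYoung : ∀ {n} → List ℕ → Permutation′ n → Set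
InYoung λs σ = ∀ i → blockOf λs (toℕ (σ ⟨$⟩ʳ i)) ≡ blockOf λs (toℕ i)

module Submission where

-- Listing the elements so that all blocks of a chain are contiguous turns the
-- chain into a word: the colours (indices of the Young factors) of the listed
-- elements, and after each element a stamp, the level at which it gets joined
-- to its right neighbour.  Sorting the subblocks inside every block yields
-- exactly one sorted word per orbit.
--
-- Replace the stamps by a permutation, breaking ties by comparing the suffixes
-- that follow the tied stamps.  This turns the sorted word of a chain x into
-- the sorted word of a maximal chain F above x.  Let D be the set of ranks r
-- for which what follows the stamp r in F does not precede what follows the
-- stamp r + 1.  A face of F standardises back to F iff its rank set contains
-- D, so the chains with maximal chain F form the interval from the restriction
-- of F to D up to F.

open import Defs
open import Data.Bool using (Bool; true; false; if_then_else_; not; T)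
open import Data.Fin using (Fin; zero; suc; toℕ; fromℕ<; punchIn; punchOut)
open import Data.Fin.Permutation using (Permutation′; permutation; _⟨$⟩ʳ_; _⟨$⟩ˡ_; inverseʳ; inverseˡ; _∘ₚ_; flip)
import Data.Fin.Permutation as Perm
import Data.Fin.Properties as Fin
open import Data.List using (List; []; _∷_; _++_; length; foldl; concat; cartesianProductWith; allFin)
open import Data.List.Membership.Propositional.Properties using (∈-allFin)
open import Data.List.Properties using (length-++; foldl-++)
open import Data.List.Relation.Binary.Pointwise using (Pointwise; []; _∷_)
import Data.List.Relation.Binary.Pointwise as Pointwise
open import Data.List.Relation.Binary.Sublist.Heterogeneous using (Sublist; []; _∷_; _∷ʳ_; lookup)
open import Data.List.Relation.Binary.Sublist.Heterogeneous.Properties using (fromPointwise; toPointwise; length-mono-≤)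
open import Data.List.Relation.Unary.All using (All; []; _∷_)
import Data.List.Relation.Unary.All as All
open import Data.List.Relation.Unary.AllPairs using (AllPairs; []; _∷_)
open import Data.List.Relation.Unary.Any using (Any; here; there)
open import Data.List.Relation.Unary.Any.Properties using (concat⁺; cartesianProductWith⁺)
open import Data.List.Relation.Unary.Linked using (Linked; []; [-]; _∷_)
open import Data.List.Relation.Unary.Linked.Properties using (AllPairs⇒Linked)
open import Data.Nat
open import Data.Nat.DivMod using (_mod_; m<n⇒m%n≡m)
open import Data.Nat.Properties
open import Data.Product using (Σ; _×_; _,_; ∃-syntax; proj₁; proj₂)
open import Data.Sum using (_⊎_; inj₁; inj₂)
open import Data.Unit using (⊤; tt)
open import Function using (_∘_)
open import Relation.Binary.Definitions using (Tri; tri<; tri≈; tri>)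
open import Relation.Binary.PropositionalEquality
open import Relation.Nullary using (¬_; yes; no; Dec; does)
open import Relation.Nullary.Decidable using (dec-true; _×-dec_; _⊎-dec_; _→-dec_; map′)
open import Relation.Nullary.Negation using (contradiction)
open import Algebra.Properties.CommutativeMonoid.Sum +-0-commutativeMonoid
  using (sum; sum-permute; sum-cong-≗)

-- Words and block codes

-- The difficulty is that sortedness is needed in two forms. Numerical codes of subblocks depend on
-- the orbit alone, which makes the word canonical, but they change completely when stamps are
-- refined or merged. Comparisons of suffixes are compatible with refining and merging, but they
-- refer to a chosen listing. The conventions are set so that the two forms agree: larger colours
-- and larger codes come first, and smaller stamps come first because a block that continues where
-- an otherwise equal one ends has the larger code. `good⇒sorted` and `sorted⇒good` are this
-- agreement; codes are used to build and identify words, suffixes to pass between a face and its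
-- facet. The stamp after the last element lies above all others, so that no suffix is a proper
-- prefix of another.

<ᵇ-true : ∀ {m n} → m < n → (m <ᵇ n) ≡ true
<ᵇ-true {m} {n} lt with m <ᵇ n | <⇒<ᵇ lt
... | true | _ = refl

<ᵇ-false : ∀ {m n} → n ≤ m → (m <ᵇ n) ≡ false
<ᵇ-false {m} {n} le with m <ᵇ n in eq
... | false = refl
... | true  = contradiction (<ᵇ⇒< m n (subst T (sym eq) tt)) (≤⇒≯ le)

≡ᵇ-true : ∀ {m n} → m ≡ n → (m ≡ᵇ n) ≡ true
≡ᵇ-true {m} {n} e with m ≡ᵇ n | ≡⇒≡ᵇ m n e
... | true | _ = refl

≡ᵇ-false : ∀ {m n} → m ≢ n → (m ≡ᵇ n) ≡ false
≡ᵇ-false {m} {n} ne with m ≡ᵇ n in eq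
... | false = refl
... | true  = contradiction (≡ᵇ⇒≡ m n (subst T (sym eq) tt)) ne

≡ᵇ-sound : ∀ m n → (m ≡ᵇ n) ≡ true → m ≡ n
≡ᵇ-sound m n e = ≡ᵇ⇒≡ m n (subst T (sym e) tt)

-- Numbering the blocks from left to right turns "in the same block" into an equation between
-- naturals, and contiguity of blocks into monotonicity of the numbering.
block : (ℕ → ℕ) → ℕ → ℕ → ℕ
block t v zero    = 0
block t v (suc p) = if t p <ᵇ v then block t v p else suc (block t v p)

module _ (t : ℕ → ℕ) (v : ℕ) where

  block-suc-≤ : ∀ p → block t v p ≤ block t v (suc p)
  block-suc-≤ p with t p <ᵇ v
  ... | true  = ≤-refl
  ... | false = n≤1+n _

  block-inside : ∀ p → t p < v → block t v (suc p) ≡ block t v p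
  block-inside p lt rewrite <ᵇ-true lt = refl

  block-boundary : ∀ p → v ≤ t p → block t v (suc p) ≡ suc (block t v p)
  block-boundary p le rewrite <ᵇ-false le = refl

  block-mono : ∀ {p q} → p ≤′ q → block t v p ≤ block t v q
  block-mono ≤′-refl = ≤-refl
  block-mono (≤′-step {n = q} le) = ≤-trans (block-mono le) (block-suc-≤ q)

  block-join : ∀ {p q} → p ≤′ q → (∀ r → p ≤ r → r < q → t r < v) →
               block t v p ≡ block t v q
  block-join ≤′-refl h = refl
  block-join (≤′-step {n = q} le) h =
    trans (block-join le (λ r pr rq → h r pr (m<n⇒m<1+n rq)))
          (sym (block-inside q (h q (≤′⇒≤ le) ≤-refl)))

  block-split : ∀ {p r q} → p ≤ r → r < q → v ≤ t r → block t v p < block t v q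
  block-split {p} {r} {q} pr rq le = ≤-trans
    (s≤s (block-mono (≤⇒≤′ pr)))
    (subst (_≤ block t v q) (block-boundary r le) (block-mono (≤⇒≤′ rq)))

  block-≡⇒inside : ∀ {p r q} → p ≤ r → r < q → block t v p ≡ block t v q → t r < v
  block-≡⇒inside {r = r} pr rq e with v ≤? t r
  ... | yes le = contradiction e (<⇒≢ (block-split pr rq le))
  ... | no ¬le = ≰⇒> ¬le

block-cong : ∀ {t s v w} p → (∀ r → r < p → (t r <ᵇ v) ≡ (s r <ᵇ w)) →
             block t v p ≡ block s w p
block-cong zero h = refl
block-cong (suc p) h = cong₂ (λ b x → if b then x else suc x)
  (h p ≤-refl) (block-cong p (λ r lt → h r (m<n⇒m<1+n lt)))

block-level-0 : ∀ t p → block t 0 p ≡ p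
block-level-0 t zero    = refl
block-level-0 t (suc p) = cong suc (block-level-0 t p)

isum : (ℕ → ℕ) → ℕ → ℕ → ℕ
isum f a zero    = 0
isum f a (suc k) = f a + isum f (suc a) k

isum-cong : ∀ {f g} a k → (∀ q → a ≤ q → q < k + a → f q ≡ g q) → isum f a k ≡ isum g a k
isum-cong a zero h = refl
isum-cong {f} {g} a (suc k) h = cong₂ _+_ (h a ≤-refl (s≤s (m≤n+m a k)))
  (isum-cong (suc a) k (λ q le lt → h q (<⇒≤ le) (subst (q <_) (+-suc k a) lt)))

isum-const : ∀ M a k → isum (λ _ → M) a k ≡ k * M
isum-const M a zero    = refl
isum-const M a (suc k) = cong (M +_) (isum-const M (suc a) k)

isum-≤ : ∀ {f M} a k → (∀ q → a ≤ q → q < k + a → f q ≤ M) → isum f a k ≤ k * M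
isum-≤ a zero h = z≤n
isum-≤ a (suc k) h = +-mono-≤ (h a ≤-refl (s≤s (m≤n+m a k)))
  (isum-≤ (suc a) k (λ q le lt → h q (<⇒≤ le) (subst (q <_) (+-suc k a) lt)))

isum-split : ∀ f a j k → isum f a (j + k) ≡ isum f a j + isum f (j + a) k
isum-split f a zero k = refl
isum-split f a (suc j) k = trans
  (cong (f a +_) (trans (isum-split f (suc a) j k)
     (cong (λ z → isum f (suc a) j + isum f z k) (+-suc j a))))
  (sym (+-assoc (f a) _ _))

isum-suc-split : ∀ f a ℓ j → isum f a (suc (suc (ℓ + j))) ≡ isum f a (suc ℓ) + isum f (suc (ℓ + a)) (suc j)
isum-suc-split f a ℓ j = trans (cong (isum f a) (sym (+-suc (suc ℓ) j))) (isum-split f a (suc ℓ) (suc j))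

isum-prefix-< : ∀ {f} → (∀ q → 0 < f q) → ∀ a ℓ j → isum f a (suc ℓ) < isum f a (suc (suc (ℓ + j)))
isum-prefix-< {f} pos a ℓ j = subst₂ _<_ (+-identityʳ _) (sym (isum-suc-split f a ℓ j))
  (+-monoʳ-< (isum f a (suc ℓ)) (<-≤-trans (pos (suc (ℓ + a))) (m≤m+n _ _)))

isum-zero : ∀ {f} a k → (∀ q → a ≤ q → q < k + a → f q ≡ 0) → isum f a k ≡ 0
isum-zero a k h = trans (isum-cong a k h) (trans (isum-const 0 a k) (*-zeroʳ k))

-- With `u = v` this is a whole block at level `v`. With `v = suc u` it is what is left of a block
-- at level `suc u` when some (possibly none) of its children, the blocks at level `u`, are removed
-- from the front. The run has `suc k` positions.
record Run (N : ℕ) (t : ℕ → ℕ) (u v a k : ℕ) : Set where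
  field
    start  : ∀ a′ → a ≡ suc a′ → u ≤ t a′
    inside : ∀ q → a ≤ q → q < k + a → t q < v
    end    : v ≤ t (k + a)
    bound  : k + a < N

open Run

findEnd : ∀ (t : ℕ → ℕ) v k a → v ≤ t (k + a) →
  ∃[ ℓ ] (ℓ ≤ k × (∀ q → a ≤ q → q < ℓ + a → t q < v) × v ≤ t (ℓ + a))
findEnd t v zero a e = 0 , z≤n , (λ q le lt → contradiction le (<⇒≱ lt)) , e
findEnd t v (suc k) a e with v ≤? t a
... | yes le = 0 , z≤n , (λ q le lt → contradiction le (<⇒≱ lt)) , le
... | no ¬le with findEnd t v k (suc a) (subst (λ z → v ≤ t z) (sym (+-suc k a)) e)
... | ℓ , ℓ≤k , ins , en =
  suc ℓ , s≤s ℓ≤k , ins′ , subst (λ z → v ≤ t z) (+-suc ℓ a) en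
  where
  ins′ : ∀ q → a ≤ q → q < suc ℓ + a → t q < v
  ins′ q le lt with m≤n⇒m<n∨m≡n le
  ... | inj₁ a<q  = ins q a<q (subst (q <_) (sym (+-suc ℓ a)) lt)
  ... | inj₂ refl = ≰⇒> ¬le

-- The recursion on lists of children rests on this. The stamp between a child and its successor is
-- exactly `v`: the child ends there, but the surrounding block does not.
firstChild : ∀ {N t v a k} → Run N t v (suc v) a k →
  ∃[ ℓ ] (Run N t v v a ℓ ×
    (ℓ ≡ k ⊎ ∃[ k′ ] (k ≡ suc (ℓ + k′) × t (ℓ + a) ≡ v × Run N t v (suc v) (suc (ℓ + a)) k′)))
firstChild {N} {t} {v} {a} {k} R
  with findEnd t v k a (≤-trans (n≤1+n v) (end R))
... | ℓ , ℓ≤k , ins , en = ℓ , R₁ , rest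
  where
  R₁ : Run N t v v a ℓ
  R₁ = record { start = start R ; inside = ins ; end = en
              ; bound = ≤-<-trans (+-monoˡ-≤ a ℓ≤k) (bound R) }
  rest : ℓ ≡ k ⊎ ∃[ k′ ] (k ≡ suc (ℓ + k′) × t (ℓ + a) ≡ v × Run N t v (suc v) (suc (ℓ + a)) k′)
  rest with m≤n⇒m<n∨m≡n ℓ≤k
  ... | inj₂ e = inj₁ e
  ... | inj₁ ℓ<k = inj₂ (k′ , k≡ , ≤-antisym (≤-pred (inside R (ℓ + a) (m≤n+m a ℓ) (+-monoˡ-< a ℓ<k))) en , R₂)
    where
    k′ : ℕ
    k′ = k ∸ suc ℓ
    k≡ : k ≡ suc (ℓ + k′)
    k≡ = sym (m+[n∸m]≡n ℓ<k)
    pos : k′ + suc (ℓ + a) ≡ k + a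
    pos = trans (sym (+-assoc k′ (suc ℓ) a)) (cong (_+ a) (m∸n+n≡m ℓ<k))
    R₂ : Run N t v (suc v) (suc (ℓ + a)) k′
    R₂ = record
      { start  = λ { _ refl → en }
      ; inside = λ q le lt → inside R q (≤-trans (m≤n+m a (suc ℓ)) le) (subst (q <_) pos lt)
      ; end    = subst (λ z → suc v ≤ t z) (sym pos) (end R)
      ; bound  = subst (_< N) (sym pos) (bound R) }

module Codes (N : ℕ) (c t : ℕ → ℕ) where

  -- In base N + 1 no carries occur, so codes at level suc v compare like the
  -- decreasing lists of the codes at level v inside the blocks, with a proper
  -- prefix below its extensions.
  wcode : ℕ → ℕ → ℕ
  weight : ℕ → ℕ → ℕ
  wcode zero p    = c p
  wcode (suc v) p =
    isum (λ q → if block t (suc v) q ≡ᵇ block t (suc v) p then weight v q else 0) 0 N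
  weight v q = suc N ^ wcode v q

  -- Codes at level `v` are constant on the blocks at level `v`, so comparing positions amounts to
  -- comparing the children of each block at level `suc v`.
  Good : ℕ → Set
  Good v = ∀ {p q} → p ≤ q → q < N → block t (suc v) p ≡ block t (suc v) q →
           wcode v q ≤ wcode v p

  wcode-cong : ∀ v {p q} → block t (suc v) p ≡ block t (suc v) q →
               wcode (suc v) p ≡ wcode (suc v) q
  wcode-cong v {p} {q} e rewrite e = refl

  run-block : ∀ {u v a k} → Run N t u v a k → ∀ {q} → a ≤ q → q ≤ k + a →
              block t v a ≡ block t v q
  run-block R le qe = block-join t _ (≤⇒≤′ le) (λ r ar rq → inside R r ar (<-≤-trans rq qe))

  run-code : ∀ v {a ℓ} → Run N t v v a ℓ → ∀ {q} → a ≤ q → q ≤ ℓ + a → wcode v q ≡ wcode v a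
  run-code (suc v) {a} R {q} le qe = wcode-cong v {q} {a} (sym (run-block R le qe))
  run-code zero {a} {zero} R le qe = cong c (≤-antisym qe le)
  run-code zero {a} {suc ℓ} R le qe with inside R a ≤-refl (s≤s (m≤n+m a ℓ))
  ... | ()

  code-of-run : ∀ v {a k} → Run N t (suc v) (suc v) a k →
                wcode (suc v) a ≡ isum (weight v) a (suc k)
  code-of-run v {a} {k} R = begin
    isum f 0 N                                              ≡⟨ cong (isum f 0) N≡ ⟩
    isum f 0 (a + (suc k + d))                              ≡⟨ isum-split f 0 a _ ⟩
    isum f 0 a + isum f (a + 0) (suc k + d)                 ≡⟨ cong₂ _+_ before (cong (λ z → isum f z (suc k + d)) (+-identityʳ a)) ⟩
    isum f a (suc k + d)                                    ≡⟨ isum-split f a (suc k) d ⟩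
    isum f a (suc k) + isum f (suc k + a) d                 ≡⟨ cong₂ _+_ during after ⟩
    isum (weight v) a (suc k) + 0                           ≡⟨ +-identityʳ _ ⟩
    isum (weight v) a (suc k)                               ∎
    where
    open ≡-Reasoning
    f : ℕ → ℕ
    f q = if block t (suc v) q ≡ᵇ block t (suc v) a then weight v q else 0
    d : ℕ
    d = N ∸ (suc k + a)
    N≡ : N ≡ a + (suc k + d)
    N≡ = begin
      N                 ≡⟨ m+[n∸m]≡n (bound R) ⟨
      suc k + a + d     ≡⟨ cong (_+ d) (+-comm (suc k) a) ⟩
      a + suc k + d     ≡⟨ +-assoc a (suc k) d ⟩
      a + (suc k + d)   ∎
    before : isum f 0 a ≡ 0
    before = isum-zero 0 a out
      where
      out : ∀ q → 0 ≤ q → q < a + 0 → f q ≡ 0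
      out q _ lt = cong (λ b → if b then weight v q else 0) (≡ᵇ-false (<⇒≢ (block-split t (suc v) {q} {pred a} {a}
        (≤-pred (subst (suc q ≤_) a≡ q<a)) (≤-reflexive (sym a≡)) (start R (pred a) a≡))))
        where
        q<a : q < a
        q<a = subst (q <_) (+-identityʳ a) lt
        a≡ : a ≡ suc (pred a)
        a≡ = sym (suc-pred a {{>-nonZero (≤-<-trans z≤n q<a)}})
    during : isum f a (suc k) ≡ isum (weight v) a (suc k)
    during = isum-cong a (suc k) same
      where
      same : ∀ q → a ≤ q → q < suc k + a → f q ≡ weight v q
      same q le lt rewrite ≡ᵇ-true (sym (run-block R le (≤-pred lt))) = refl
    after : isum f (suc k + a) d ≡ 0
    after = isum-zero (suc k + a) d out
      where
      out : ∀ q → suc k + a ≤ q → q < d + (suc k + a) → f q ≡ 0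
      out q le lt rewrite ≡ᵇ-false (λ e → <⇒≢ (block-split t (suc v) {a} {k + a} {q}
               (m≤n+m a k) le (end R)) (sym e)) = refl

  module _ {v} (good : Good v) {a k} (R : Run N t v (suc v) a k) where

    tail-code-≤ : ∀ {q} → a ≤ q → q ≤ k + a → wcode v q ≤ wcode v a
    tail-code-≤ le qe = good le (≤-<-trans qe (bound R)) (run-block R le qe)

    -- The absence of carries: `Good` makes the first term the largest, and there are at most `N`
    -- terms.
    tail-sum-< : isum (weight v) a (suc k) < suc N ^ suc (wcode v a)
    tail-sum-< = ≤-<-trans
      (isum-≤ a (suc k) (λ q le lt → ^-monoʳ-≤ (suc N) (tail-code-≤ le (≤-pred lt))))
      (*-monoˡ-< (suc N ^ wcode v a) {{m^n≢0 (suc N) (wcode v a)}}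
        (s≤s (≤-trans (s≤s (m≤m+n k a)) (bound R))))

    tail-sum-≥ : suc N ^ wcode v a ≤ isum (weight v) a (suc k)
    tail-sum-≥ = m≤m+n _ _

  -- Codes sum over positions, not over children, so a child counts once for each of its positions.
  -- The comparison survives this because children with equal codes turn out to have equal lengths.
  child-sum : ∀ {v a ℓ} → Run N t v v a ℓ →
              isum (weight v) a (suc ℓ) ≡ suc ℓ * weight v a
  child-sum {v} {a} {ℓ} R = trans
    (isum-cong a (suc ℓ) (λ q le lt → cong (suc N ^_) (run-code v R le (≤-pred lt))))
    (isum-const _ a (suc ℓ))

  weight-pos : ∀ v q → 0 < weight v q
  weight-pos v q = m^n>0 (suc N) (wcode v q)

-- Rl and Nx are relations between suffixes of the two words, starting at the
-- colour, respectively at the stamp, of the given positions.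
module Compare (N : ℕ) (c t c′ t′ : ℕ → ℕ) (Rl Nx : Bool → ℕ → ℕ → Set)
  (colour< : ∀ {a b} → c′ b < c a → Rl true a b)
  (colour≡ : ∀ {β a b} → c a ≡ c′ b → Nx β a b → Rl β a b)
  (stamp<  : ∀ {a b} → t a < t′ b → Nx true a b)
  (stamp≡  : ∀ {β a b} → t a ≡ t′ b → Rl β (suc a) (suc b) → Nx β a b)
  where

  private
    module W  = Codes N c t
    module W′ = Codes N c′ t′

  -- The Boolean lets one recursion serve two purposes: `true` is meant for "comes before", `false`
  -- for "reads the same". A larger code settles the order by the closing stamps at the latest.
  -- Equal codes leave it open, and carry whatever holds from the closing stamps on back to the
  -- openings.
  Verdict : (x y : ℕ) (a k b k′ : ℕ) → Set
  Verdict x y a k b k′ =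
    (y < x → Rl true a b) ×
    (x ≡ y → k ≡ k′ × (∀ β → Nx β (k + a) (k′ + b) → Rl β a b))

  module _ (v : ℕ) (good : W.Good v) (good′ : W′.Good v)
    (compare-runs : ∀ {a k b k′} → Run N t v v a k → Run N t′ v v b k′ →
                    Verdict (W.wcode v a) (W′.wcode v b) a k b k′) where

    S S′ : ℕ → ℕ → ℕ
    S  a k = isum (W.weight v) a (suc k)
    S′ b k = isum (W′.weight v) b (suc k)

    compare-tails : ∀ fuel {a k b k′} → k < fuel →
      Run N t v (suc v) a k → Run N t′ v (suc v) b k′ → Verdict (S a k) (S′ b k′) a k b k′
    compare-tails (suc fuel) {a} {k} {b} {k′} k<fuel R R′
      with firstChild R | firstChild R′
    ... | ℓ , Ra , resta | ℓ′ , Rb , restb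
      with <-cmp (W.wcode v a) (W′.wcode v b)
    ... | tri< lt _ _ = (λ gt → contradiction gt (<⇒≯ S<)) , (λ e → contradiction e (<⇒≢ S<))
      where
      S< : S a k < S′ b k′
      S< = <-≤-trans (W.tail-sum-< good R)
             (≤-trans (^-monoʳ-≤ (suc N) lt) (W′.tail-sum-≥ good′ R′))
    ... | tri> _ _ gt = (λ _ → proj₁ (compare-runs Ra Rb) gt) , (λ e → contradiction (sym e) (<⇒≢ S>))
      where
      S> : S′ b k′ < S a k
      S> = <-≤-trans (W′.tail-sum-< good′ R′)
             (≤-trans (^-monoʳ-≤ (suc N) gt) (W.tail-sum-≥ good R))
    ... | tri≈ _ eq _ with proj₂ (compare-runs Ra Rb) eq
    ... | refl , continue = go resta restb
      where
      children≡ : isum (W.weight v) a (suc ℓ) ≡ isum (W′.weight v) b (suc ℓ)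
      children≡ = trans (W.child-sum Ra)
        (trans (cong (λ z → suc ℓ * suc N ^ z) eq) (sym (W′.child-sum Rb)))

      go : ℓ ≡ k ⊎ ∃[ j ] (k ≡ suc (ℓ + j) × t (ℓ + a) ≡ v × Run N t v (suc v) (suc (ℓ + a)) j) →
           ℓ ≡ k′ ⊎ ∃[ j ] (k′ ≡ suc (ℓ + j) × t′ (ℓ + b) ≡ v × Run N t′ v (suc v) (suc (ℓ + b)) j) →
           Verdict (S a k) (S′ b k′) a k b k′
      go (inj₁ refl) (inj₁ refl) =
        (λ lt → contradiction (sym children≡) (<⇒≢ lt)) , (λ _ → refl , continue)
      go (inj₁ refl) (inj₂ (j , refl , _ , Rj)) =
        (λ lt → contradiction lt (<⇒≯ S<)) , (λ e → contradiction e (<⇒≢ S<))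
        where
        S< : S a ℓ < S′ b (suc (ℓ + j))
        S< = subst (_< S′ b (suc (ℓ + j))) (sym children≡) (isum-prefix-< (W′.weight-pos v) b ℓ j)
      -- The second block ends with a stamp above `v` where the first goes on after the stamp `v`.
      -- The extension has both the larger code and the smaller stamp.
      go (inj₂ (j , refl , tv , Rj)) (inj₁ refl) =
        (λ _ → continue true (stamp< (subst (_< t′ (ℓ + b)) (sym tv) (end R′)))) ,
        (λ e → contradiction (sym e) (<⇒≢ S>))
        where
        S> : S′ b ℓ < S a (suc (ℓ + j))
        S> = subst (_< S a (suc (ℓ + j))) children≡ (isum-prefix-< (W.weight-pos v) a ℓ j)
      go (inj₂ (j , refl , tv , Rj)) (inj₂ (j′ , refl , tv′ , Rj′)) =
        (λ lt → next true (proj₁ IH (+-cancelˡ-< X _ _ (subst₂ _<_ eq₂ eq₁ lt)))) ,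
        (λ e → let j≡ , f = proj₂ IH (+-cancelˡ-≡ X _ _ (trans (sym eq₁) (trans e eq₂))) in
               cong (λ z → suc (ℓ + z)) j≡ ,
               λ β nx → next β (f β (subst₂ (Nx β) (pos j a) (pos j′ b) nx)))
        where
        X : ℕ
        X = isum (W.weight v) a (suc ℓ)
        IH : Verdict (S (suc (ℓ + a)) j) (S′ (suc (ℓ + b)) j′) (suc (ℓ + a)) j (suc (ℓ + b)) j′
        IH = compare-tails fuel (≤-pred (≤-trans (s≤s (s≤s (m≤n+m j ℓ))) k<fuel)) Rj Rj′
        next : ∀ β → Rl β (suc (ℓ + a)) (suc (ℓ + b)) → Rl β a b
        next β r = continue β (stamp≡ (trans tv (sym tv′)) r)
        eq₁ : S a (suc (ℓ + j)) ≡ X + S (suc (ℓ + a)) j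
        eq₁ = isum-suc-split (W.weight v) a ℓ j
        eq₂ : S′ b (suc (ℓ + j′)) ≡ X + S′ (suc (ℓ + b)) j′
        eq₂ = trans (isum-suc-split (W′.weight v) b ℓ j′)
                (cong (_+ S′ (suc (ℓ + b)) j′) (sym children≡))
        pos : ∀ j a → suc (ℓ + j) + a ≡ j + suc (ℓ + a)
        pos j a = trans (cong (λ z → suc (z + a)) (+-comm ℓ j))
                    (trans (cong suc (+-assoc j ℓ a)) (sym (+-suc j (ℓ + a))))

  -- Induction on the level: blocks at level `suc v` are compared through their lists of children.
  -- Sortedness is assumed strictly below `v`, so that `sorted⇒good` can establish it level by
  -- level.
  compare-codes : ∀ v → (∀ w → w < v → W.Good w) → (∀ w → w < v → W′.Good w) →
    ∀ {a k b k′} → Run N t v v a k → Run N t′ v v b k′ →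
    Verdict (W.wcode v a) (W′.wcode v b) a k b k′
  compare-codes zero _ _ {a} {zero} {b} {zero} R R′ = colour< , (λ e → refl , λ β → colour≡ e)
  compare-codes zero _ _ {a} {suc k} R R′ with inside R a ≤-refl (s≤s (m≤n+m a k))
  ... | ()
  compare-codes zero _ _ {b = b} {suc k′} R R′ with inside R′ b ≤-refl (s≤s (m≤n+m b k′))
  ... | ()
  compare-codes (suc v) good good′ {a} {k} {b} {k′} R R′ =
    subst₂ (λ x y → Verdict x y a k b k′) (sym (W.code-of-run v R)) (sym (W′.code-of-run v R′))
      (compare-tails v (good v ≤-refl) (good′ v ≤-refl)
        (compare-codes v (λ w lt → good w (m<n⇒m<1+n lt)) (λ w lt → good′ w (m<n⇒m<1+n lt)))
        (suc k) ≤-refl (weaken R) (weaken R′))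
    where
    weaken : ∀ {t a k} → Run N t (suc v) (suc v) a k → Run N t v (suc v) a k
    weaken R = record { start = λ a′ e → <⇒≤ (start R a′ e) ; inside = inside R
                      ; end = end R ; bound = bound R }

-- Sorted words

-- Two runs of a block that are both preceded by its outermost stamp, or the
-- first of which opens the block, begin at positions ordered by ≺.
SiblingsSorted : ℕ → (ℕ → ℕ) → (ℕ → ℕ → Set) → Set
SiblingsSorted M t _≺_ = ∀ a b → a ≤ b → b < M →
  (∀ a′ → a ≡ suc a′ → t b ≤ t a′) → (∀ q → a ≤ q → q < b → t q ≤ t b) → a ≺ suc b

findStart : ∀ (t : ℕ → ℕ) v p → ∃[ a ] (a ≤ p × (∀ a′ → a ≡ suc a′ → v ≤ t a′) ×
                                       (∀ r → a ≤ r → r < p → t r < v))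
findStart t v zero = 0 , z≤n , (λ _ ()) , (λ _ _ ())
findStart t v (suc p) with v ≤? t p
... | yes le = suc p , ≤-refl , (λ { _ refl → le }) , (λ r le lt → contradiction le (<⇒≱ lt))
... | no ¬le with findStart t v p
... | a , a≤p , st , ins = a , m≤n⇒m≤1+n a≤p , st , ins′
  where
  ins′ : ∀ r → a ≤ r → r < suc p → t r < v
  ins′ r le lt with m≤n⇒m<n∨m≡n (≤-pred lt)
  ... | inj₁ r<p  = ins r le r<p
  ... | inj₂ refl = ≰⇒> ¬le

module _ (M : ℕ) (c t : ℕ → ℕ) (_≺_ : ℕ → ℕ → Set)
  (last    : ∀ p → p < M → t p < t M)
  (colour< : ∀ {a b} → c b < c a → a ≺ b)
  (stamp<  : ∀ {a b} → c a ≡ c b → t a < t b → a ≺ b)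
  (stamp≡  : ∀ {a b} → c a ≡ c b → t a ≡ t b → suc a ≺ suc b → a ≺ b)
  where

  open Codes (suc M) c t

  private
    Nx : Bool → ℕ → ℕ → Set
    Nx _ a b = t a < t b ⊎ (t a ≡ t b × suc a ≺ suc b)

    colour≡ : ∀ {a b} → c a ≡ c b → Nx true a b → a ≺ b
    colour≡ e (inj₁ lt) = stamp< e lt
    colour≡ e (inj₂ (te , s)) = stamp≡ e te s

  open Compare (suc M) c t c t (λ _ → _≺_) Nx colour< colour≡ inj₁ (λ e s → inj₂ (e , s))

  -- Siblings with different codes are ordered by `compare-codes`. If the codes are equal, the
  -- siblings spell the same word and the closing stamps decide; if these are equal too, the
  -- comparison moves on to the next children, which are siblings in the same block again.
  good⇒sorted : ∀ V → (∀ p → p < M → t p < V) → (∀ v → v < V → Good v) →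
                SiblingsSorted M t _≺_
  good⇒sorted V t<V good a b = go (suc M) a b (m≤m+n (suc M) b)
    where
    -- Every round moves `b` strictly to the right, so its distance from the end bounds the
    -- recursion.
    go : ∀ fuel a b → suc M ≤ fuel + b → a ≤ b → b < M →
      (∀ a′ → a ≡ suc a′ → t b ≤ t a′) → (∀ q → a ≤ q → q < b → t q ≤ t b) → a ≺ suc b
    go zero a b fuel≥ a≤b b<M st ins = contradiction b<M (<⇒≯ fuel≥)
    go (suc fuel) a b fuel≥ a≤b b<M st ins
      with findEnd t (t b) (b ∸ a) a (≤-reflexive (cong t (sym (m∸n+n≡m a≤b))))
         | findEnd t (t b) (M ∸ suc b) (suc b)
             (subst (λ z → t b ≤ t z) (sym (m∸n+n≡m b<M)) (<⇒≤ (last b b<M)))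
    ... | ℓ , ℓ≤ , insₐ , enₐ | ℓ′ , ℓ′≤ , insᵦ , enᵦ = decide (m≤n⇒m<n∨m≡n code≤)
      where
      v : ℕ
      v = t b
      ℓ+a≤b : ℓ + a ≤ b
      ℓ+a≤b = ≤-trans (+-monoˡ-≤ a ℓ≤) (≤-reflexive (m∸n+n≡m a≤b))
      ins≤ : ∀ q → a ≤ q → q ≤ b → t q ≤ v
      ins≤ q le qb with m≤n⇒m<n∨m≡n qb
      ... | inj₁ lt   = ins q le lt
      ... | inj₂ refl = ≤-refl
      Rₐ : Run (suc M) t v v a ℓ
      Rₐ = record { start = st ; inside = insₐ ; end = enₐ
                  ; bound = s≤s (≤-trans ℓ+a≤b (<⇒≤ b<M)) }
      Rᵦ : Run (suc M) t v v (suc b) ℓ′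
      Rᵦ = record { start = λ { _ refl → ≤-refl } ; inside = insᵦ ; end = enᵦ
                  ; bound = s≤s (≤-trans (+-monoˡ-≤ (suc b) ℓ′≤) (≤-reflexive (m∸n+n≡m b<M))) }
      code≤ : wcode v (suc b) ≤ wcode v a
      code≤ = good v (t<V b b<M) (m≤n⇒m≤1+n a≤b) (s≤s b<M)
        (block-join t (suc v) (≤⇒≤′ (m≤n⇒m≤1+n a≤b))
          (λ r ar rb → s≤s (ins≤ r ar (≤-pred rb))))
      lower : ∀ w → w < v → Good w
      lower w lt = good w (<-trans lt (t<V b b<M))
      verdict : Verdict (wcode v a) (wcode v (suc b)) a ℓ (suc b) ℓ′
      verdict = compare-codes v lower lower Rₐ Rᵦ
      decide : wcode v (suc b) < wcode v a ⊎ wcode v (suc b) ≡ wcode v a → a ≺ suc b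
      decide (inj₁ lt) = proj₁ verdict lt
      decide (inj₂ e) with proj₂ verdict (sym e)
      ... | refl , continue = continue true (next (m≤n⇒m<n∨m≡n enᵦ))
        where
        tₐ : t (ℓ + a) ≡ v
        tₐ = ≤-antisym (ins≤ (ℓ + a) (m≤n+m a ℓ) ℓ+a≤b) enₐ
        next : v < t (ℓ + suc b) ⊎ v ≡ t (ℓ + suc b) → Nx true (ℓ + a) (ℓ + suc b)
        -- The second sibling is the last child of its block while the first is followed by another
        -- child.
        next (inj₁ lt) = inj₁ (subst (_< t (ℓ + suc b)) (sym tₐ) lt)
        next (inj₂ tᵦ) = inj₂ (trans tₐ tᵦ , go fuel (suc (ℓ + a)) (ℓ + suc b)
          (≤-trans fuel≥ (≤-trans (≤-reflexive (sym (+-suc fuel b))) (+-monoʳ-≤ fuel (m≤n+m (suc b) ℓ))))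
          (≤-trans (s≤s ℓ+a≤b) (m≤n+m (suc b) ℓ))
          b₁<M
          (λ { _ refl → ≤-reflexive (trans (sym tᵦ) (sym tₐ)) })
          ins₁)
          where
          b₁<M : ℓ + suc b < M
          b₁<M with m≤n⇒m<n∨m≡n (≤-pred (bound Rᵦ))
          ... | inj₁ lt = lt
          ... | inj₂ eq = contradiction (trans tᵦ (cong t eq)) (<⇒≢ (last b b<M))
          ins₁ : ∀ q → suc (ℓ + a) ≤ q → q < ℓ + suc b → t q ≤ t (ℓ + suc b)
          ins₁ q le lt with q ≤? b
          ... | yes q≤b = ≤-trans (ins≤ q (≤-trans (m≤n+m a (suc ℓ)) le) q≤b) (≤-reflexive tᵦ)
          ... | no  q≰b = ≤-trans (<⇒≤ (insᵦ q (≰⇒> q≰b) lt)) (≤-reflexive tᵦ)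

  module _ (asym : ∀ {a b} → a ≺ b → ¬ (b ≺ a)) (sorted : SiblingsSorted M t _≺_) where

    private
      runAt : ∀ v p → p ≤ M → v ≤ t M →
              ∃[ a ] ∃[ ℓ ] (Run (suc M) t v v a ℓ × a ≤ p × p ≤ ℓ + a)
      runAt v p p≤M v≤ with findStart t v p
      ... | a , a≤p , st , ins with findEnd t v (M ∸ a) a
              (subst (λ z → v ≤ t z) (sym (m∸n+n≡m (≤-trans a≤p p≤M))) v≤)
      ... | ℓ , ℓ≤ , insₐ , enₐ = a , ℓ ,
        record { start = st ; inside = insₐ ; end = enₐ
               ; bound = s≤s (≤-trans (+-monoˡ-≤ a ℓ≤) (≤-reflexive (m∸n+n≡m (≤-trans a≤p p≤M)))) } ,
        a≤p , p≤
        where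
        p≤ : p ≤ ℓ + a
        p≤ with p ≤? ℓ + a
        ... | yes le = le
        ... | no ¬le = contradiction enₐ (<⇒≱ (ins (ℓ + a) (m≤n+m a ℓ) (≰⇒> ¬le)))

    -- If a later child had the larger code, `compare-codes` would put its suffix first, against the
    -- order of siblings.
    sorted⇒good : ∀ v → Good v
    sorted⇒good v = below (suc v) v ≤-refl
      where
      below : ∀ V v → v < V → Good v
      below (suc V) v v<V {p} {q} p≤q q<N eq with v ≤? t M
      -- At a level above the last stamp the whole word is one block.
      ... | no ¬le = small (≰⇒> ¬le)
        where
        small : t M < v → wcode v q ≤ wcode v p
        small (s≤s {n = v′} le) = ≤-reflexive (wcode-cong v′ {q} {p} (sym
          (block-join t (suc v′) (≤⇒≤′ p≤q)
            (λ r pr rq → s≤s (≤-trans (<⇒≤ (last r (<-≤-trans rq (≤-pred q<N)))) le)))))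
      ... | yes v≤M with runAt v p (≤-trans p≤q (≤-pred q<N)) v≤M | runAt v q (≤-pred q<N) v≤M
      ... | a , ℓ , Rₐ , a≤p , p≤ | b , ℓ′ , Rᵦ , b≤q , q≤ =
        subst₂ _≤_ (sym (run-code v Rᵦ b≤q q≤)) (sym (run-code v Rₐ a≤p p≤)) main
        where
        lower : ∀ w → w < v → Good w
        lower w lt = below V w (<-≤-trans lt (≤-pred v<V))
        main : wcode v b ≤ wcode v a
        main with wcode v b ≤? wcode v a
        ... | yes le = le
        ... | no ¬le with <-cmp a b
        ... | tri≈ _ refl _ = ≤-refl
        ... | tri> _ _ (s≤s {n = a′} b≤a′) =
          contradiction (start Rₐ a′ refl)
            (<⇒≱ (inside Rᵦ a′ b≤a′ (<-≤-trans a≤p (≤-trans p≤q q≤))))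
        ... | tri< (s≤s {n = b′} a≤b′) _ _ =
          contradiction (proj₁ (compare-codes v lower lower Rᵦ Rₐ) (≰⇒> ¬le)) (asym a≺b)
          where
          v≤ : v ≤ t b′
          v≤ = start Rᵦ b′ refl
          p≤b′ : p ≤ b′
          p≤b′ with p ≤? b′
          ... | yes le = le
          ... | no ¬le′ = contradiction v≤ (<⇒≱ (inside Rₐ b′ a≤b′ (<-≤-trans (≰⇒> ¬le′) p≤)))
          tv : t b′ ≡ v
          tv = ≤-antisym (≤-pred (block-≡⇒inside t (suc v) p≤b′ b≤q eq)) v≤
          a≺b : a ≺ suc b′
          a≺b = sorted a b′ a≤b′ (≤-trans b≤q (≤-pred q<N))
            (λ a′ e → subst (_≤ t a′) (sym tv) (start Rₐ a′ e)) ins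
            where
            ins : ∀ r → a ≤ r → r < b′ → t r ≤ t b′
            ins r ar rb with r <? p
            ... | yes r<p = ≤-trans (<⇒≤ (inside Rₐ r ar (<-≤-trans r<p p≤))) v≤
            ... | no  r≮p = subst (t r ≤_) (sym tv) (≤-pred
                    (block-≡⇒inside t (suc v) (≮⇒≥ r≮p) (<-≤-trans rb (≤-trans (n≤1+n b′) b≤q)) eq))

-- Each word is a single run at level `V`, and with `Rl false` read as agreement of all later
-- letters, equality of the codes carries agreement back to position `0`. The stamps at `M` stay out
-- of the conclusion, since a code does not record the stamp that closes its run.
good-word-unique : ∀ M V {c t c′ t′ : ℕ → ℕ} →
  (∀ p → p < M → t p < V) → V ≤ t M → (∀ p → p < M → t′ p < V) → V ≤ t′ M →
  (∀ v → v < V → Codes.Good (suc M) c t v) → (∀ v → v < V → Codes.Good (suc M) c′ t′ v) →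
  Codes.wcode (suc M) c t V 0 ≡ Codes.wcode (suc M) c′ t′ V 0 →
  ∀ j → j ≤ M → c j ≡ c′ j × (j < M → t j ≡ t′ j)
good-word-unique M V {c} {t} {c′} {t′} t< V≤t t′< V≤t′ good good′ e j j≤ =
  subst (λ z → c z ≡ c′ z × (z < M → t z ≡ t′ z)) (+-identityʳ j)
    (proj₂ (proj₂ (compare-codes V good good′ (whole t< V≤t) (whole t′< V≤t′)) e) false
       (at-end , λ i lt → contradiction (subst (suc i + (M + 0) ≤_) (sym (+-identityʳ M)) lt)
                            (<⇒≱ (s≤s (m≤n+m (M + 0) i))))
       j (subst (_≤ M) (sym (+-identityʳ j)) j≤))
  where
  Rl Nx : Bool → ℕ → ℕ → Set
  Rl true  a b = ⊤
  Rl false a b = ∀ i → i + a ≤ M → c (i + a) ≡ c′ (i + b) × (i + a < M → t (i + a) ≡ t′ (i + b))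
  Nx true  a b = ⊤
  Nx false a b = (a < M → t a ≡ t′ b) ×
    (∀ i → suc i + a ≤ M →
      c (suc i + a) ≡ c′ (suc i + b) × (suc i + a < M → t (suc i + a) ≡ t′ (suc i + b)))
  colour≡ : ∀ {β a b} → c a ≡ c′ b → Nx β a b → Rl β a b
  colour≡ {true} _ _ = tt
  colour≡ {false} e (te , _) zero    _  = e , te
  colour≡ {false} e (_ , f)  (suc i) le = f i le
  stamp≡ : ∀ {β a b} → t a ≡ t′ b → Rl β (suc a) (suc b) → Nx β a b
  stamp≡ {true} _ _ = tt
  stamp≡ {false} {a} {b} e f = (λ _ → e) , λ i le →
    subst₂ (λ x y → c x ≡ c′ y × (x < M → t x ≡ t′ y)) (+-suc i a) (+-suc i b)
      (f i (subst (_≤ M) (sym (+-suc i a)) le))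
  open Compare (suc M) c t c′ t′ Rl Nx (λ _ → tt) colour≡ (λ _ → tt) stamp≡
  at-end : M + 0 < M → t (M + 0) ≡ t′ (M + 0)
  at-end lt = contradiction (subst (_< M) (+-identityʳ M) lt) (n≮n M)
  whole : ∀ {t : ℕ → ℕ} → (∀ p → p < M → t p < V) → V ≤ t M → Run (suc M) t V V 0 M
  whole {t} t< V≤ = record
    { start = λ _ () ; inside = λ q _ lt → t< q (subst (q <_) (+-identityʳ M) lt)
    ; end = subst (λ z → V ≤ t z) (sym (+-identityʳ M)) V≤
    ; bound = s≤s (≤-reflexive (+-identityʳ M)) }

module _ (M : ℕ) (s t : ℕ → ℕ) (_≺_ : ℕ → ℕ → Set)
  (refines : ∀ {p q} → p < M → q < M → t p < t q → s p < s q)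
  where

  private
    coarse-≤ : ∀ {p q} → p < M → q < M → s p ≤ s q → t p ≤ t q
    coarse-≤ p< q< le = ≮⇒≥ (λ lt → contradiction (refines q< p< lt) (≤⇒≯ le))

  -- Siblings for `s` are siblings for `t`, so refining the stamps only removes conditions.
  sorted-refine : SiblingsSorted M t _≺_ → SiblingsSorted M s _≺_
  sorted-refine sorted a b a≤b b<M st ins = sorted a b a≤b b<M
    (λ { a′ refl → coarse-≤ b<M (≤-trans a≤b (<⇒≤ b<M)) (st a′ refl) })
    (λ q aq qb → coarse-≤ (<-trans qb b<M) b<M (ins q aq qb))

  -- Look at the start of the `s`-run that reaches `b`. If it is at or before `a`, then either `a`
  -- and `suc b` are siblings for `s` as well, or the stamp before `a` ties with that of `b` and
  -- `ties` gives the order. If it is at some `suc q` beyond `a`, then `q` ties with `b`, and `ties`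
  -- contradicts the order of the `s`-siblings `suc q` and `suc b`.
  sorted-coarsen : (∀ {a b} → a ≺ b → ¬ (b ≺ a)) →
    (∀ {p q} → p < M → q < M → t p ≡ t q → s p < s q → suc p ≺ suc q) →
    SiblingsSorted M s _≺_ → SiblingsSorted M t _≺_
  sorted-coarsen asym ties sorted a b a≤b b<M st ins with findStart s (suc (s b)) b
  ... | a₀ , a₀≤b , st₀ , ins₀ with a₀ ≤? a
  sorted-coarsen asym ties sorted a b a≤b b<M st ins | a₀ , a₀≤b , st₀ , ins₀ | yes a₀≤a = from a refl
    where
    ins′ : ∀ q → a ≤ q → q < b → s q ≤ s b
    ins′ q aq qb = ≤-pred (ins₀ q (≤-trans a₀≤a aq) qb)
    from : ∀ x → a ≡ x → a ≺ suc b
    from zero refl = sorted a b a≤b b<M (λ _ ()) ins′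
    from (suc a′) refl with s b ≤? s a′
    ... | yes le = sorted a b a≤b b<M (λ { _ refl → le }) ins′
    ... | no ¬le = ties a′<M b<M
      (≤-antisym (coarse-≤ a′<M b<M (<⇒≤ (≰⇒> ¬le))) (st a′ refl)) (≰⇒> ¬le)
      where
      a′<M : a′ < M
      a′<M = ≤-trans a≤b (<⇒≤ b<M)
  ... | no a₀≰a with a₀
  ... | zero  = contradiction z≤n a₀≰a
  ... | suc q = contradiction (sorted (suc q) b a₀≤b b<M (λ a′ e → <⇒≤ (st₀ a′ e))
                  (λ r qr rb → ≤-pred (ins₀ r qr rb)))
                  (asym (ties b<M q<M (≤-antisym (coarse-≤ b<M q<M (<⇒≤ sb<sq)) (ins q (≤-pred (≰⇒> a₀≰a)) a₀≤b)) sb<sq))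
    where
    q<M : q < M
    q<M = <-trans a₀≤b b<M
    sb<sq : s b < s q
    sb<sq = st₀ q refl

-- Finite sums and rankings

sum-mono-≤ : ∀ {n} {f g : Fin n → ℕ} → (∀ i → f i ≤ g i) → sum f ≤ sum g
sum-mono-≤ {zero}  h = z≤n
sum-mono-≤ {suc n} h = +-mono-≤ (h zero) (sum-mono-≤ (h ∘ suc))

sum-mono-< : ∀ {n} {f g : Fin n → ℕ} → (∀ i → f i ≤ g i) → ∀ j → f j < g j → sum f < sum g
sum-mono-< h zero    lt = +-mono-<-≤ lt (sum-mono-≤ (h ∘ suc))
sum-mono-< h (suc j) lt = +-mono-≤-< (h zero) (sum-mono-< (h ∘ suc) j lt)

sum-1 : ∀ n → sum {n} (λ _ → 1) ≡ n
sum-1 zero    = refl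
sum-1 (suc n) = cong suc (sum-1 n)

isum-as-sum : ∀ {f} {n} {g : Fin n → ℕ} a → (∀ i → f (toℕ i + a) ≡ g i) → isum f a n ≡ sum g
isum-as-sum {n = zero}  a h = refl
isum-as-sum {f} {suc n} a h = cong₂ _+_ (h zero)
  (isum-as-sum (suc a) (λ i → trans (cong f (+-suc (toℕ i) a)) (h (suc i))))

-- A missed value could be punched out, giving an injection into a smaller `Fin`.
injective⇒permutation : ∀ {n} (f : Fin n → Fin n) → (∀ {i j} → f i ≡ f j → i ≡ j) →
                        Σ (Permutation′ n) λ π → ∀ i → π ⟨$⟩ʳ i ≡ f i
injective⇒permutation {zero}  f inj = permutation f f (λ ()) (λ ()) , λ ()
injective⇒permutation {suc n} f inj =
  permutation f (proj₁ ∘ preimage) (proj₂ ∘ preimage)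
    (λ x → inj (proj₂ (preimage (f x)))) , λ _ → refl
  where
  preimage : ∀ y → ∃[ x ] f x ≡ y
  preimage y with Fin.any? (λ x → f x Fin.≟ y)
  ... | yes found = found
  ... | no missed = contradiction (Fin.injective⇒≤ avoid-injective) 1+n≰n
    where
    avoids : ∀ x → y ≢ f x
    avoids x e = missed (x , sym e)
    avoid-injective : ∀ {i j} → punchOut (avoids i) ≡ punchOut (avoids j) → i ≡ j
    avoid-injective e = inj (Fin.punchOut-injective (avoids _) (avoids _) e)

module _ {n : ℕ} (_≺_ : Fin n → Fin n → Set)
  (irrefl : ∀ {i} → ¬ (i ≺ i)) (≺-trans : ∀ {i j k} → i ≺ j → j ≺ k → i ≺ k)
  (total : ∀ i j → i ≺ j ⊎ i ≡ j ⊎ j ≺ i) where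

  private
    ind : ∀ {i j} → i ≺ j ⊎ i ≡ j ⊎ j ≺ i → ℕ
    ind (inj₁ _) = 1
    ind (inj₂ _) = 0

    ind-1 : ∀ {i j} (d : i ≺ j ⊎ i ≡ j ⊎ j ≺ i) → i ≺ j → ind d ≡ 1
    ind-1 (inj₁ _)           lt = refl
    ind-1 (inj₂ (inj₁ refl)) lt = contradiction lt irrefl
    ind-1 (inj₂ (inj₂ gt))   lt = contradiction (≺-trans lt gt) irrefl

    ind-0 : ∀ {i} (d : i ≺ i ⊎ i ≡ i ⊎ i ≺ i) → ind d ≡ 0
    ind-0 (inj₁ lt) = contradiction lt irrefl
    ind-0 (inj₂ _)  = refl

    ind-≤1 : ∀ {i j} (d : i ≺ j ⊎ i ≡ j ⊎ j ≺ i) → ind d ≤ 1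
    ind-≤1 (inj₁ _) = ≤-refl
    ind-≤1 (inj₂ _) = z≤n

    ind-mono : ∀ {h i j} → i ≺ j → (d : h ≺ i ⊎ h ≡ i ⊎ i ≺ h) (d′ : h ≺ j ⊎ h ≡ j ⊎ j ≺ h) →
               ind d ≤ ind d′
    ind-mono lt (inj₁ hi) d′ = ≤-reflexive (sym (ind-1 d′ (≺-trans hi lt)))
    ind-mono lt (inj₂ _)  d′ = z≤n

    below : Fin n → ℕ
    below i = sum (λ h → ind (total h i))

    below-< : ∀ {i j} → i ≺ j → below i < below j
    below-< {i} {j} lt = sum-mono-< (λ h → ind-mono lt (total h i) (total h j)) i
      (subst₂ _<_ (sym (ind-0 (total i i))) (sym (ind-1 (total i j) lt)) z<s)

    below-bound : ∀ i → below i < n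
    below-bound i = subst (below i <_) (sum-1 n)
      (sum-mono-< (λ h → ind-≤1 (total h i)) i (subst (_< 1) (sym (ind-0 (total i i))) z<s))

    below-injective : ∀ {i j} → below i ≡ below j → i ≡ j
    below-injective {i} {j} e with total i j
    ... | inj₁ lt = contradiction e (<⇒≢ (below-< lt))
    ... | inj₂ (inj₁ eq) = eq
    ... | inj₂ (inj₂ gt) = contradiction (sym e) (<⇒≢ (below-< gt))

    ranking : Σ (Permutation′ n) λ π → ∀ i → π ⟨$⟩ʳ i ≡ fromℕ< (below-bound i)
    ranking = injective⇒permutation (λ i → fromℕ< (below-bound i))
      (λ e → below-injective (Fin.fromℕ<-injective _ _ _ _ e))

  opaque

    rank : Permutation′ n
    rank = proj₁ ranking

    rank-mono : ∀ {i j} → i ≺ j → toℕ (rank ⟨$⟩ʳ i) < toℕ (rank ⟨$⟩ʳ j)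
    rank-mono {i} {j} lt = subst₂ _<_ (sym (value i)) (sym (value j)) (below-< lt)
      where
      value : ∀ i → toℕ (rank ⟨$⟩ʳ i) ≡ below i
      value i = trans (cong toℕ (proj₂ ranking i)) (Fin.toℕ-fromℕ< (below-bound i))

    rank-reflects : ∀ {i j} → toℕ (rank ⟨$⟩ʳ i) < toℕ (rank ⟨$⟩ʳ j) → i ≺ j
    rank-reflects {i} {j} lt with total i j
    ... | inj₁ p = p
    ... | inj₂ (inj₁ refl) = contradiction lt (n≮n _)
    ... | inj₂ (inj₂ gt) = contradiction lt (<⇒≯ (rank-mono gt))

-- Arranging a chain

module _ {n : ℕ} where

  rel-cong : (u : Partition n) → ∀ {e f} → rel u e f ≡ true → ∀ h → rel u h e ≡ rel u h f
  rel-cong u {e} {f} r h with rel u h e in he | rel u h f in hf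
  ... | true  | true  = refl
  ... | false | false = refl
  ... | true  | false = trans (sym (relTrans u h e f he r)) hf
  ... | false | true  = trans (sym he) (relTrans u h f e hf (relSym u e f r))

  firstTrue : ∀ {m} → (Fin m → Bool) → ℕ
  firstTrue {zero}  p = 0
  firstTrue {suc m} p = if p zero then 0 else suc (firstTrue (p ∘ suc))

  firstTrue-cong : ∀ {m} {p q : Fin m → Bool} → (∀ i → p i ≡ q i) → firstTrue p ≡ firstTrue q
  firstTrue-cong {zero}  h = refl
  firstTrue-cong {suc m} h = cong₂ (λ b x → if b then 0 else suc x) (h zero) (firstTrue-cong (h ∘ suc))

  firstTrue-common : ∀ {m} (p q : Fin m → Bool) i → p i ≡ true → ∀ j → q j ≡ true →
                     firstTrue p ≡ firstTrue q → ∃[ h ] (p h ≡ true × q h ≡ true)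
  firstTrue-common {suc m} p q i pi j qj e with p zero in p0 | q zero in q0
  ... | true | true = zero , p0 , q0
  firstTrue-common {suc m} p q zero pi j qj e | false | false = contradiction (trans (sym p0) pi) λ ()
  firstTrue-common {suc m} p q (suc i) pi zero qj e | false | false = contradiction (trans (sym q0) qj) λ ()
  firstTrue-common {suc m} p q (suc i) pi (suc j) qj e | false | false
    with firstTrue-common (p ∘ suc) (q ∘ suc) i pi j qj (suc-injective e)
  ... | h , ph , qh = suc h , ph , qh

  -- Distinct blocks may have equal codes and would then interleave; their least elements break the
  -- tie and keep each block contiguous.
  representative : Partition n → Fin n → ℕ
  representative u e = firstTrue (λ h → rel u h e)

  representative-cong : ∀ u {e f} → rel u e f ≡ true → representative u e ≡ representative u f
  representative-cong u r = firstTrue-cong (rel-cong u r)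

  representative-≡⇒rel : ∀ u {e f} → representative u e ≡ representative u f → rel u e f ≡ true
  representative-≡⇒rel u {e} {f} eq
    with firstTrue-common (λ h → rel u h e) (λ h → rel u h f) e (relRefl u e) f (relRefl u f) eq
  ... | h , he , hf = relTrans u e h f (relSym u h e he) hf

  related-above : ∀ {u : Partition n} {us e f} → Linked _<P_ (u ∷ us) → rel u e f ≡ true →
                  All (λ v → rel v e f ≡ true) (u ∷ us)
  related-above [-] r = r ∷ []
  related-above {e = e} {f} (u<v ∷ L) r = r ∷ related-above L (proj₁ u<v e f r)

  -- The recursion of `wcode` indexed by elements instead of positions, hence available before any
  -- listing is chosen and independent of it.
  codeStep : Partition n → (Fin n → ℕ) → Fin n → ℕ
  codeStep u g e = sum (λ h → if rel u h e then suc n ^ g h else 0)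

  codeStep-cong : ∀ u g {e f} → rel u e f ≡ true → codeStep u g e ≡ codeStep u g f
  codeStep-cong u g r = sum-cong-≗ (λ h → cong (λ b → if b then suc n ^ g h else 0) (rel-cong u r h))

  data Key (k : Fin n → ℕ) (R : Fin n → Fin n → Set) (e f : Fin n) : Set where
    larger : k f < k e → Key k R e f
    tied   : k f ≡ k e → R e f → Key k R e f

  record IsStrictTotal (R : Fin n → Fin n → Set) : Set where
    field
      irrefl : ∀ {i} → ¬ R i i
      transitive : ∀ {i j k} → R i j → R j k → R i k
      total  : ∀ i j → R i j ⊎ i ≡ j ⊎ R j i
  open IsStrictTotal public

  Key-strictTotal : ∀ k {R} → IsStrictTotal R → IsStrictTotal (Key k R)
  Key-strictTotal k {R} S = record { irrefl = irr ; transitive = tr ; total = tot }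
    where
    irr : ∀ {i} → ¬ Key k R i i
    irr (larger lt) = n≮n _ lt
    irr (tied _ r)  = irrefl S r
    tr : ∀ {a b c} → Key k R a b → Key k R b c → Key k R a c
    tr (larger p) (larger q) = larger (<-trans q p)
    tr (larger p) (tied e _) = larger (<-≤-trans (s≤s (≤-reflexive e)) p)
    tr (tied e _) (larger q) = larger (<-≤-trans q (≤-reflexive e))
    tr (tied e r) (tied e′ r′) = tied (trans e′ e) (transitive S r r′)
    tot : ∀ i j → Key k R i j ⊎ i ≡ j ⊎ Key k R j i
    tot i j with <-cmp (k i) (k j) | total S i j
    ... | tri< lt _ _ | _ = inj₂ (inj₂ (larger lt))
    ... | tri> _ _ gt | _ = inj₁ (larger gt)
    ... | tri≈ _ e _  | inj₁ r = inj₁ (tied (sym e) r)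
    ... | tri≈ _ e _  | inj₂ (inj₁ r) = inj₂ (inj₁ r)
    ... | tri≈ _ e _  | inj₂ (inj₂ r) = inj₂ (inj₂ (tied e r))

  Key-≤ : ∀ {k R e f} → Key k R e f → k f ≤ k e
  Key-≤ (larger lt) = <⇒≤ lt
  Key-≤ (tied eq _) = ≤-reflexive eq

  Key-tie : ∀ {k R e f} → k e ≡ k f → Key k R e f → R e f
  Key-tie eq (larger lt) = contradiction (sym eq) (<⇒≢ lt)
  Key-tie eq (tied _ r)  = r

  stepOrder : Partition n → (Fin n → ℕ) → (Fin n → Fin n → Set) → Fin n → Fin n → Set
  stepOrder u g R = Key (codeStep u g) (Key (representative u) R)

  -- Compares elements at the highest level that separates them: first by code,
  -- larger codes coming first, then by block.
  chainOrder : List (Partition n) → (Fin n → ℕ) → (Fin n → Fin n → Set) → Fin n → Fin n → Set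
  chainOrder []       g R = R
  chainOrder (u ∷ us) g R = chainOrder us (codeStep u g) (stepOrder u g R)

  chainOrder-strictTotal : ∀ us g {R} → IsStrictTotal R → IsStrictTotal (chainOrder us g R)
  chainOrder-strictTotal []       g S = S
  chainOrder-strictTotal (u ∷ us) g S =
    chainOrder-strictTotal us _ (Key-strictTotal _ (Key-strictTotal _ S))

  stepOrder-tie : ∀ u g {R e f} → rel u e f ≡ true → stepOrder u g R e f → R e f
  stepOrder-tie u g r o = Key-tie (representative-cong u r) (Key-tie (codeStep-cong u g r) o)

  chainOrder-tie : ∀ us g R {e f} → All (λ u → rel u e f ≡ true) us → chainOrder us g R e f → R e f
  chainOrder-tie []       g R []       o = o
  chainOrder-tie (u ∷ us) g R (r ∷ rs) o = stepOrder-tie u g r (chainOrder-tie us _ (stepOrder u g R) rs o)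

  -- This is contiguity of the blocks. Once `e`, `h` and `f` are related at all higher levels, the
  -- order compares codes and representatives at `u`, and those of `h` are squeezed between the
  -- equal ones of `e` and `f`.
  chainOrder-between : ∀ us g R {e h f} → All (λ u → rel u e f ≡ true) us →
    chainOrder us g R e h → chainOrder us g R h f → All (λ u → rel u e h ≡ true) us
  chainOrder-between [] g R [] _ _ = []
  chainOrder-between (u ∷ us) g R {e} {h} {f} (r ∷ rs) eh hf = u-eh ∷ us-eh
    where
    us-eh : All (λ v → rel v e h ≡ true) us
    us-eh = chainOrder-between us _ (stepOrder u g R) rs eh hf
    us-hf : All (λ v → rel v h f ≡ true) us
    us-hf = All.zipWith (λ {v} (a , b) → relTrans v h e f (relSym v e h a) b) (us-eh , rs)
    s₁ : stepOrder u g R e h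
    s₁ = chainOrder-tie us _ (stepOrder u g R) us-eh eh
    s₂ : stepOrder u g R h f
    s₂ = chainOrder-tie us _ (stepOrder u g R) us-hf hf
    code≡ : codeStep u g h ≡ codeStep u g e
    code≡ = ≤-antisym (Key-≤ s₁) (≤-trans (≤-reflexive (codeStep-cong u g r)) (Key-≤ s₂))
    code≡′ : codeStep u g h ≡ codeStep u g f
    code≡′ = trans code≡ (codeStep-cong u g r)
    rep≡ : representative u h ≡ representative u e
    rep≡ = ≤-antisym (Key-≤ (Key-tie (sym code≡) s₁))
      (≤-trans (≤-reflexive (representative-cong u r)) (Key-≤ (Key-tie code≡′ s₂)))
    u-eh : rel u e h ≡ true
    u-eh = representative-≡⇒rel u (sym rep≡)

  firstRel : ℕ → List (Partition n) → Fin n → Fin n → ℕ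
  firstRel i []       e f = i
  firstRel i (u ∷ us) e f = if rel u e f then i else firstRel (suc i) us e f

  firstRel-≥ : ∀ i us e f → i ≤ firstRel i us e f
  firstRel-≥ i []       e f = ≤-refl
  firstRel-≥ i (u ∷ us) e f with rel u e f
  ... | true  = ≤-refl
  ... | false = <⇒≤ (firstRel-≥ (suc i) us e f)

  firstRel-≤ : ∀ i x e f → firstRel i (x ++ 1̂ ∷ []) e f ≤ length x + i
  firstRel-≤ i []      e f = ≤-refl
  firstRel-≤ i (u ∷ x) e f with rel u e f
  ... | true  = m≤n+m i (suc (length x))
  ... | false = subst (firstRel (suc i) (x ++ 1̂ ∷ []) e f ≤_) (+-suc (length x) i) (firstRel-≤ (suc i) x e f)

module _ (M : ℕ) where

  -- π sends an element to its position in the word.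
  position : Permutation′ (suc M) → Fin (suc M) → ℕ
  position π e = toℕ (π ⟨$⟩ʳ e)

  opaque

    element : Permutation′ (suc M) → ℕ → Fin (suc M)
    element π p = π ⟨$⟩ˡ (p mod suc M)

    position-element : ∀ π {p} → p < suc M → position π (element π p) ≡ p
    position-element π {p} p< = trans (cong toℕ (inverseʳ π))
      (trans (Fin.toℕ-fromℕ< _) (m<n⇒m%n≡m p<))

    element-cong : ∀ {π π′} → (∀ i → π ⟨$⟩ʳ i ≡ π′ ⟨$⟩ʳ i) → ∀ p → element π p ≡ element π′ p
    element-cong {π} {π′} h p = trans (cong (π ⟨$⟩ˡ_) (sym (inverseʳ π′)))
      (trans (cong (π ⟨$⟩ˡ_) (sym (h _))) (inverseˡ π))

  position-bound : ∀ π e → position π e ≤ M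
  position-bound π e = ≤-pred (Fin.toℕ<n (π ⟨$⟩ʳ e))

  position-injective : ∀ π {e f} → position π e ≡ position π f → e ≡ f
  position-injective π {e} {f} eq = trans (sym (inverseˡ π))
    (trans (cong (π ⟨$⟩ˡ_) (Fin.toℕ-injective eq)) (inverseˡ π))

  element-position : ∀ π e → element π (position π e) ≡ e
  element-position π e = position-injective π (position-element π (s≤s (position-bound π e)))

  Realises : Permutation′ (suc M) → (ℕ → ℕ) → ℕ → List (Partition (suc M)) → Set
  Realises π t i []       = ⊤
  Realises π t i (u ∷ us) =
    (∀ e f → rel u e f ≡ (block t (suc i) (position π e) ≡ᵇ block t (suc i) (position π f))) ×
    Realises π t (suc i) us

  module _ (π : Permutation′ (suc M)) (c t : ℕ → ℕ) where

    open Codes (suc M) c t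

    -- The permutation `π` reindexes the sum over positions as a sum over elements.
    codeStep-realised : ∀ i u g →
      (∀ e f → rel u e f ≡ (block t (suc i) (position π e) ≡ᵇ block t (suc i) (position π f))) →
      (∀ e → wcode i (position π e) ≡ g e) → ∀ e → wcode (suc i) (position π e) ≡ codeStep u g e
    codeStep-realised i u g real h e =
      trans (isum-as-sum {F} {suc M} {F ∘ toℕ} 0 (λ j → cong F (+-identityʳ (toℕ j))))
        (trans (sum-permute (F ∘ toℕ) π)
          (sum-cong-≗ (λ j → cong₂ (λ b x → if b then suc (suc M) ^ x else 0) (sym (real j e)) (h j))))
      where
      F : ℕ → ℕ
      F q = if block t (suc i) q ≡ᵇ block t (suc i) (position π e) then weight i q else 0

    code-realised : ∀ i us g → Realises π t i us → (∀ e → wcode i (position π e) ≡ g e) →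
      ∀ e → wcode (length us + i) (position π e) ≡ foldl (λ g u → codeStep u g) g us e
    code-realised i []       g _ h e = h e
    code-realised i (u ∷ us) g (r , rs) h e =
      subst (λ v → wcode v (position π e) ≡ foldl (λ g u → codeStep u g) (codeStep u g) us e)
        (+-suc (length us) i)
        (code-realised (suc i) us (codeStep u g) rs (codeStep-realised i u g r h) e)

  -- The top level `length x` belongs to `1̂`, and `t-last` lies one above it, closing the word.
  -- `attained` records the strictness of the chain: each of its levels performs some join.
  record Arrangement (col : Fin (suc M) → ℕ) (x : List (Partition (suc M))) : Set where
    field
      π        : Permutation′ (suc M)
      t        : ℕ → ℕ
      t-last   : t M ≡ suc (length x)
      t-bound  : ∀ p → p < M → t p ≤ length x
      realises : Realises π t 0 (x ++ 1̂ ∷ [])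
      good     : ∀ v → v < suc (length x) → Codes.Good (suc M) (col ∘ element π) t v
      attained : ∀ i → i ≤ length x → ∃[ p ] (p < M × t p ≡ i)

  module _ (col : Fin (suc M) → ℕ) (x : List (Partition (suc M)))
    (linked : Linked _<P_ (0̂ ∷ x ++ 1̂ ∷ [])) where

    private
      y : List (Partition (suc M))
      y = x ++ 1̂ ∷ []

      R₀ : Fin (suc M) → Fin (suc M) → Set
      R₀ = Key col (λ e f → toℕ e < toℕ f)

      R₀-strictTotal : IsStrictTotal R₀
      R₀-strictTotal = Key-strictTotal col record
        { irrefl = n≮n _ ; transitive = <-trans ; total = tot }
        where
        tot : ∀ (i j : Fin (suc M)) → toℕ i < toℕ j ⊎ i ≡ j ⊎ toℕ j < toℕ i
        tot i j with <-cmp (toℕ i) (toℕ j)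
        ... | tri< lt _ _ = inj₁ lt
        ... | tri≈ _ e _  = inj₂ (inj₁ (Fin.toℕ-injective e))
        ... | tri> _ _ gt = inj₂ (inj₂ gt)

      R : Fin (suc M) → Fin (suc M) → Set
      R = chainOrder y col R₀

      S : IsStrictTotal R
      S = chainOrder-strictTotal y col R₀-strictTotal

      ρ : Permutation′ (suc M)
      ρ = rank R (irrefl S) (transitive S) (total S)

      el : ℕ → Fin (suc M)
      el = element ρ

      pos : Fin (suc M) → ℕ
      pos = position ρ

      before : ∀ {p q} → p < q → q ≤ M → R (el p) (el q)
      before lt le = rank-reflects R (irrefl S) (transitive S) (total S)
        (subst₂ _<_ (sym (position-element ρ (<-trans lt (s≤s le)))) (sym (position-element ρ (s≤s le))) lt)

      stamp : ℕ → ℕ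
      stamp p = if p <ᵇ M then firstRel 0 y (el p) (el (suc p)) else suc (length x)

      stamp-inner : ∀ {p} → p < M → stamp p ≡ firstRel 0 y (el p) (el (suc p))
      stamp-inner lt rewrite <ᵇ-true lt = refl

      stamp-last : stamp M ≡ suc (length x)
      stamp-last rewrite <ᵇ-false (≤-refl {M}) = refl

      stamp-bound : ∀ p → p < M → stamp p ≤ length x
      stamp-bound p lt = subst (_≤ length x) (sym (stamp-inner lt))
        (subst (firstRel 0 y (el p) (el (suc p)) ≤_) (+-identityʳ (length x))
          (firstRel-≤ 0 x (el p) (el (suc p))))

      -- Invariant of the walk up the chain: either two neighbours have been joined earlier and stay
      -- joined, or their stamp is still to be found in the remaining part.
      Pending : ℕ → List (Partition (suc M)) → Set
      Pending i us = ∀ p → p < M →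
        (stamp p < i × All (λ u → rel u (el p) (el (suc p)) ≡ true) us) ⊎
        stamp p ≡ firstRel i us (el p) (el (suc p))

      pending-step : ∀ {i u us} → Linked _<P_ (u ∷ us) → Pending i (u ∷ us) →
        ∀ p → p < M →
        (rel u (el p) (el (suc p)) ≡ true × stamp p < suc i ×
           All (λ u → rel u (el p) (el (suc p)) ≡ true) us) ⊎
        (rel u (el p) (el (suc p)) ≡ false × suc i ≤ stamp p ×
           stamp p ≡ firstRel (suc i) us (el p) (el (suc p)))
      pending-step {i} {u} {us} L P p lt with P p lt
      ... | inj₁ (s< , r ∷ rs) = inj₁ (r , m<n⇒m<1+n s< , rs)
      ... | inj₂ e with rel u (el p) (el (suc p)) in r
      ... | true  = inj₁ (refl , s≤s (≤-reflexive e) , All.tail (related-above L r))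
      ... | false = inj₂ (refl , subst (suc i ≤_) (sym e) (firstRel-≥ (suc i) us _ _) , e)

      pending-tail : ∀ {i u us} → Linked _<P_ (u ∷ us) → Pending i (u ∷ us) → Pending (suc i) us
      pending-tail L P p lt with pending-step L P p lt
      ... | inj₁ (_ , s< , rs) = inj₁ (s< , rs)
      ... | inj₂ (_ , _ , e)   = inj₂ e

      -- u ∷ us is the part of the chain still to be processed; g and Q are the
      -- codes and the order produced by the part below it.
      module Level (i : ℕ) (u : Partition (suc M)) (us : List (Partition (suc M)))
        (g : Fin (suc M) → ℕ) (Q : Fin (suc M) → Fin (suc M) → Set)
        (order : ∀ {e f} → R e f → chainOrder (u ∷ us) g Q e f)
        (L : Linked _<P_ (u ∷ us)) (P : Pending i (u ∷ us)) where

        convex : ∀ {p q r} → p ≤ r → r ≤ q → q ≤ M → rel u (el p) (el q) ≡ true →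
                 rel u (el p) (el r) ≡ true
        convex {p} {q} {r} pr rq qM e with m≤n⇒m<n∨m≡n pr | m≤n⇒m<n∨m≡n rq
        ... | inj₂ refl | _ = relRefl u (el p)
        ... | _ | inj₂ refl = e
        ... | inj₁ p<r | inj₁ r<q = All.head (chainOrder-between (u ∷ us) g Q (related-above L e)
                (order (before p<r (≤-trans rq qM))) (order (before r<q qM)))

        rel⇒inside : ∀ {p q} → q ≤ M → rel u (el p) (el q) ≡ true →
                     ∀ r → p ≤ r → r < q → stamp r < suc i
        rel⇒inside {p} {q} qM e r pr rq with pending-step L P r (<-≤-trans rq qM)
        ... | inj₁ (_ , lt , _) = lt
        ... | inj₂ (no-rel , _ , _) = contradiction (trans (sym no-rel) linked′) λ ()
          where
          linked′ : rel u (el r) (el (suc r)) ≡ true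
          linked′ = relTrans u _ _ _ (relSym u _ _ (convex pr (<⇒≤ rq) qM e))
                      (convex (m≤n⇒m≤1+n pr) rq qM e)

        inside⇒rel : ∀ {p q} → p ≤′ q → q ≤ M → (∀ r → p ≤ r → r < q → stamp r < suc i) →
                     rel u (el p) (el q) ≡ true
        inside⇒rel ≤′-refl qM h = relRefl u _
        inside⇒rel {p} (≤′-step {n = q} pq) qM h with pending-step L P q qM
        ... | inj₁ (r , _ , _) = relTrans u _ _ _
                (inside⇒rel pq (<⇒≤ qM) (λ r pr rq → h r pr (m<n⇒m<1+n rq))) r
        ... | inj₂ (_ , le , _) = contradiction (h q (≤′⇒≤ pq) ≤-refl) (≤⇒≯ le)

        rel⇒block : ∀ {p q} → p ≤ q → q ≤ M → rel u (el p) (el q) ≡ true →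
                    block stamp (suc i) p ≡ block stamp (suc i) q
        rel⇒block pq qM e = block-join stamp (suc i) (≤⇒≤′ pq) (rel⇒inside qM e)

        block⇒rel : ∀ {p q} → p ≤ q → q ≤ M → block stamp (suc i) p ≡ block stamp (suc i) q →
                    rel u (el p) (el q) ≡ true
        block⇒rel pq qM e = inside⇒rel (≤⇒≤′ pq) qM (λ r pr rq → block-≡⇒inside stamp (suc i) pr rq e)

        rel≡block : ∀ e f → rel u e f ≡ (block stamp (suc i) (pos e) ≡ᵇ block stamp (suc i) (pos f))
        rel≡block e f = subst₂ (λ a b → rel u a b ≡ (block stamp (suc i) (pos e) ≡ᵇ block stamp (suc i) (pos f)))
          (element-position ρ e) (element-position ρ f)
          (main (pos e) (pos f) (position-bound ρ e) (position-bound ρ f))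
          where
          main : ∀ p q → p ≤ M → q ≤ M →
                 rel u (el p) (el q) ≡ (block stamp (suc i) p ≡ᵇ block stamp (suc i) q)
          main p q pM qM with rel u (el p) (el q) in r | ≤-total p q
          ... | true  | inj₁ pq = sym (≡ᵇ-true (rel⇒block pq qM r))
          ... | true  | inj₂ qp = sym (≡ᵇ-true (sym (rel⇒block qp pM (relSym u _ _ r))))
          ... | false | inj₁ pq = sym (≡ᵇ-false λ e →
                  contradiction (trans (sym r) (block⇒rel pq qM e)) λ ())
          ... | false | inj₂ qp = sym (≡ᵇ-false λ e →
                  contradiction (trans (sym r) (relSym u _ _ (block⇒rel qp pM (sym e)))) λ ())

      -- Inside a block of the first remaining partition the order is `Q`, which by `mono` lists
      -- larger codes first; this is `Good i`. Both conclusions are proved together because `g`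
      -- gives the codes of the next level only when the current partition is realised.
      real-good : ∀ i us g Q → (∀ {e f} → R e f → chainOrder us g Q e f) →
        (∀ {e f} → Q e f → g f ≤ g e) → Linked _<P_ us → Pending i us →
        (∀ e → Codes.wcode (suc M) (col ∘ el) stamp i (pos e) ≡ g e) →
        Realises ρ stamp i us ×
        (∀ v → i ≤ v → v < length us + i → Codes.Good (suc M) (col ∘ el) stamp v)
      real-good i [] g Q order mono L P code = tt , λ v iv vi → contradiction vi (≤⇒≯ iv)
      real-good i (u ∷ us) g Q order mono L P code = (rel≡block , proj₁ rest) , goods
        where
        open Level i u us g Q order L P
        open Codes (suc M) (col ∘ el) stamp
        tail : ∀ {us} → Linked _<P_ (u ∷ us) → Linked _<P_ us
        tail [-]     = []
        tail (_ ∷ l) = l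
        rest : Realises ρ stamp (suc i) us × (∀ v → suc i ≤ v → v < length us + suc i → Good v)
        rest = real-good (suc i) us (codeStep u g) (stepOrder u g Q) order Key-≤ (tail L)
          (pending-tail L P) (codeStep-realised ρ (col ∘ el) stamp i u g rel≡block code)
        good-i : Good i
        good-i {p} {q} pq qN e with m≤n⇒m<n∨m≡n pq
        ... | inj₂ refl = ≤-refl
        ... | inj₁ p<q = subst₂ _≤_ (code-at (≤-pred qN)) (code-at (≤-trans pq (≤-pred qN)))
                (mono (chainOrder-tie (u ∷ us) g Q
                  (related-above L (block⇒rel pq (≤-pred qN) e)) (order (before p<q (≤-pred qN)))))
          where
          code-at : ∀ {p} → p ≤ M → g (el p) ≡ wcode i p
          code-at {p} le = trans (sym (code (el p))) (cong (wcode i) (position-element ρ (s≤s le)))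
        goods : ∀ v → i ≤ v → v < suc (length us) + i → Good v
        goods v iv vi with m≤n⇒m<n∨m≡n iv
        ... | inj₂ refl = good-i
        ... | inj₁ i<v  = proj₂ rest v i<v (subst (v <_) (sym (+-suc (length us) i)) vi)

      -- Without a stamp `i`, the levels `i` and `suc i` would have the same blocks, against the
      -- strictness of the chain. The induction starts from `0̂` at level `0`, where every position
      -- is a block.
      attains : ∀ i u us →
        (∀ e f → block stamp i (pos e) ≡ block stamp i (pos f) → rel u e f ≡ true) →
        Linked _<P_ (u ∷ us) → Realises ρ stamp i us →
        ∀ j → i ≤ j → j < length us + i → ∃[ p ] (p < M × stamp p ≡ j)
      attains i u [] _ _ _ j ij ji = contradiction ji (≤⇒≯ ij)
      attains i u (w ∷ us) prev (u<w ∷ L) (real , reals) j ij ji with m≤n⇒m<n∨m≡n ij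
      ... | inj₁ i<j = attains (suc i) w us
              (λ e f b → trans (real e f) (≡ᵇ-true b)) L reals j i<j (subst (j <_) (sym (+-suc (length us) i)) ji)
      ... | inj₂ refl with anyUpTo? (λ p → stamp p ≟ i) M
      ... | yes found = found
      ... | no ¬found = contradiction w≤u (proj₂ u<w)
        where
        same-level : ∀ {p q} → p ≤ q → q ≤ M → block stamp (suc i) p ≡ block stamp (suc i) q →
                     block stamp i p ≡ block stamp i q
        same-level pq qM e = block-join stamp i (≤⇒≤′ pq) (λ r pr rq →
          ≤∧≢⇒< (≤-pred (block-≡⇒inside stamp (suc i) pr rq e)) (λ eq → ¬found (r , <-≤-trans rq qM , eq)))
        w≤u : w ≤P u
        w≤u e f r = prev e f main
          where
          b : block stamp (suc i) (pos e) ≡ block stamp (suc i) (pos f)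
          b = ≡ᵇ-sound _ _ (trans (sym (real e f)) r)
          main : block stamp i (pos e) ≡ block stamp i (pos f)
          main with ≤-total (pos e) (pos f)
          ... | inj₁ le = same-level le (position-bound ρ f) b
          ... | inj₂ ge = sym (same-level ge (position-bound ρ e) (sym b))

      y-linked : Linked _<P_ y
      y-linked = tail linked
        where
        tail : ∀ {u us} → Linked _<P_ (u ∷ us) → Linked _<P_ us
        tail [-]     = []
        tail (_ ∷ l) = l

      length-y : length y + 0 ≡ suc (length x)
      length-y = trans (+-identityʳ _) (trans (length-++ x) (+-comm (length x) 1))

    opaque

      arrange : Arrangement col x
      arrange = record
        { π = ρ ; t = stamp ; t-last = stamp-last ; t-bound = stamp-bound
        ; realises = proj₁ rg
        ; good = λ v lt → proj₂ rg v z≤n (subst (v <_) (sym length-y) lt)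
        ; attained = λ i le → attains 0 0̂ y
            (λ e f b → subst (λ z → rel 0̂ e z ≡ true)
              (position-injective ρ (trans (sym (block-level-0 stamp _)) (trans b (block-level-0 stamp _))))
              (relRefl 0̂ e))
            linked (proj₁ rg) i z≤n (subst (i <_) (sym length-y) (s≤s le)) }
        where
        rg : Realises ρ stamp 0 y × (∀ v → 0 ≤ v → v < length y + 0 → Codes.Good (suc M) (col ∘ el) stamp v)
        rg = real-good 0 y col R₀ (λ r → r) Key-≤ y-linked (λ p lt → inj₂ (stamp-inner lt))
               (λ e → cong col (element-position ρ e))

-- Standardisation

-- When the stamps are pairwise distinct, this single letter decides between two suffixes.
Precedes : (c s : ℕ → ℕ) → ℕ → ℕ → Set
Precedes c s a b = c b < c a ⊎ (c a ≡ c b × s a < s b)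

precedes-trans : ∀ c s {x y z} → Precedes c s x y → Precedes c s y z → Precedes c s x z
precedes-trans c s (inj₁ p) (inj₁ q) = inj₁ (<-trans q p)
precedes-trans c s (inj₁ p) (inj₂ (e , _)) = inj₁ (≤-<-trans (≤-reflexive (sym e)) p)
precedes-trans c s (inj₂ (e , _)) (inj₁ q) = inj₁ (<-≤-trans q (≤-reflexive (sym e)))
precedes-trans c s (inj₂ (e , p)) (inj₂ (e′ , q)) = inj₂ (trans e e′ , <-trans p q)

precedes-asym : ∀ c s {x y} → Precedes c s x y → ¬ Precedes c s y x
precedes-asym c s p q with precedes-trans c s p q
... | inj₁ lt = n≮n _ lt
... | inj₂ (_ , lt) = n≮n _ lt

-- A derivation reaches the first letter that differs, so properties follow by induction on it
-- although words are functions on all of `ℕ`.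
data SuffixBefore (c t : ℕ → ℕ) (a b : ℕ) : Set where
  differ  : Precedes c t a b → SuffixBefore c t a b
  agree : c a ≡ c b → t a ≡ t b → SuffixBefore c t (suc a) (suc b) → SuffixBefore c t a b

module _ {c t : ℕ → ℕ} where

  suffix-irrefl : ∀ {a b} → a ≡ b → ¬ SuffixBefore c t a b
  suffix-irrefl refl (differ p) = precedes-asym c t p p
  suffix-irrefl refl (agree _ _ s) = suffix-irrefl refl s

  suffix-trans : ∀ {x y z} → SuffixBefore c t x y → SuffixBefore c t y z → SuffixBefore c t x z
  suffix-trans (differ p) (differ q) = differ (precedes-trans c t p q)
  suffix-trans (differ (inj₁ p)) (agree ce _ _) = differ (inj₁ (≤-<-trans (≤-reflexive (sym ce)) p))
  suffix-trans (differ (inj₂ (e , p))) (agree ce te _) = differ (inj₂ (trans e ce , <-≤-trans p (≤-reflexive te)))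
  suffix-trans (agree ce _ _) (differ (inj₁ q)) = differ (inj₁ (<-≤-trans q (≤-reflexive (sym ce))))
  suffix-trans (agree ce te _) (differ (inj₂ (e , q))) = differ (inj₂ (trans ce e , ≤-<-trans (≤-reflexive te) q))
  suffix-trans (agree ce te s) (agree ce′ te′ s′) = agree (trans ce ce′) (trans te te′) (suffix-trans s s′)

  suffix-asym : ∀ {a b} → SuffixBefore c t a b → ¬ SuffixBefore c t b a
  suffix-asym p q = suffix-irrefl refl (suffix-trans p q)

module _ (M : ℕ) where

  at : ℕ → Fin (suc M)
  at p = p mod suc M

  toℕ-at : ∀ {p} → p ≤ M → toℕ (at p) ≡ p
  toℕ-at le = trans (Fin.toℕ-fromℕ< _) (m<n⇒m%n≡m (s≤s le))

  at-toℕ : ∀ i → at (toℕ i) ≡ i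
  at-toℕ i = Fin.toℕ-injective (toℕ-at (≤-pred (Fin.toℕ<n i)))

  opaque

    stampOf : Permutation′ (suc M) → ℕ → ℕ
    stampOf s p = toℕ (s ⟨$⟩ʳ at p)

    placeOf : Permutation′ (suc M) → ℕ → ℕ
    placeOf s r = toℕ (s ⟨$⟩ˡ at r)

    stampOf-value : ∀ s i → stampOf s (toℕ i) ≡ toℕ (s ⟨$⟩ʳ i)
    stampOf-value s i = cong (λ j → toℕ (s ⟨$⟩ʳ j)) (at-toℕ i)

    stampOf-cong : ∀ {s s′} → (∀ i → s ⟨$⟩ʳ i ≡ s′ ⟨$⟩ʳ i) → ∀ p → stampOf s p ≡ stampOf s′ p
    stampOf-cong h p = cong toℕ (h (at p))

    stampOf-≤ : ∀ s p → stampOf s p ≤ M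
    stampOf-≤ s p = ≤-pred (Fin.toℕ<n (s ⟨$⟩ʳ at p))

    placeOf-≤ : ∀ s r → placeOf s r ≤ M
    placeOf-≤ s r = ≤-pred (Fin.toℕ<n (s ⟨$⟩ˡ at r))

    stamp-place : ∀ s {r} → r ≤ M → stampOf s (placeOf s r) ≡ r
    stamp-place s {r} le = trans (cong (λ j → toℕ (s ⟨$⟩ʳ j)) (at-toℕ _))
      (trans (cong toℕ (inverseʳ s)) (toℕ-at le))

    place-stamp : ∀ s {p} → p ≤ M → placeOf s (stampOf s p) ≡ p
    place-stamp s {p} le = trans (cong (λ j → toℕ (s ⟨$⟩ˡ j)) (at-toℕ _))
      (trans (cong toℕ (inverseˡ s)) (toℕ-at le))

  stampOf-injective : ∀ s {p q} → p ≤ M → q ≤ M → stampOf s p ≡ stampOf s q → p ≡ q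
  stampOf-injective s p≤ q≤ e =
    trans (sym (place-stamp s p≤)) (trans (cong (placeOf s) e) (place-stamp s q≤))

  -- In `ties` one letter of each suffix is enough, because its stamp is already a rank that encodes
  -- how the rest compares.
  record Standardises (c t : ℕ → ℕ) (s : Permutation′ (suc M)) : Set where
    field
      refines : ∀ {p q} → p ≤ M → q ≤ M → t p < t q → stampOf s p < stampOf s q
      ties    : ∀ {p q} → p < M → q < M → t p ≡ t q → stampOf s p < stampOf s q →
                Precedes c (stampOf s) (suc p) (suc q)

  open Standardises

  module _ {c t : ℕ → ℕ} (last : ∀ p → p < M → t p < t M) where

    private
      -- The strictly largest stamp sits at `M`, so two different suffixes differ at the latest when
      -- one of them gets there.
      suffix-total : ∀ fuel a b → M ≤ fuel + a → a ≤ M → b ≤ M → a ≢ b →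
                     SuffixBefore c t a b ⊎ SuffixBefore c t b a
      suffix-total fuel a b f≥ a≤ b≤ ne with <-cmp (c a) (c b) | <-cmp (t a) (t b)
      ... | tri< lt _ _ | _ = inj₂ (differ (inj₁ lt))
      ... | tri> _ _ gt | _ = inj₁ (differ (inj₁ gt))
      ... | tri≈ _ e _ | tri< lt _ _ = inj₁ (differ (inj₂ (e , lt)))
      ... | tri≈ _ e _ | tri> _ _ gt = inj₂ (differ (inj₂ (sym e , gt)))
      ... | tri≈ _ ce _ | tri≈ _ te _ with m≤n⇒m<n∨m≡n a≤ | m≤n⇒m<n∨m≡n b≤
      ... | inj₂ refl | inj₂ refl = contradiction refl ne
      ... | inj₂ refl | inj₁ lt   = contradiction (sym te) (<⇒≢ (last b lt))
      ... | inj₁ lt   | inj₂ refl = contradiction te (<⇒≢ (last a lt))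
      suffix-total zero a b f≥ a≤ b≤ ne | tri≈ _ ce _ | tri≈ _ te _ | inj₁ a< | inj₁ b< =
        contradiction a< (≤⇒≯ f≥)
      suffix-total (suc fuel) a b f≥ a≤ b≤ ne | tri≈ _ ce _ | tri≈ _ te _ | inj₁ a< | inj₁ b<
        with suffix-total fuel (suc a) (suc b) (subst (M ≤_) (sym (+-suc fuel a)) f≥) a< b<
               (ne ∘ suc-injective)
      ... | inj₁ s = inj₁ (agree ce te s)
      ... | inj₂ s = inj₂ (agree (sym ce) (sym te) s)

      _⊏_ : Fin (suc M) → Fin (suc M) → Set
      i ⊏ j = t (toℕ i) < t (toℕ j) ⊎
              (t (toℕ i) ≡ t (toℕ j) × SuffixBefore c t (suc (toℕ i)) (suc (toℕ j)))

      ⊏-irrefl : ∀ {i} → ¬ (i ⊏ i)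
      ⊏-irrefl (inj₁ lt) = n≮n _ lt
      ⊏-irrefl (inj₂ (_ , s)) = suffix-irrefl refl s

      ⊏-trans : ∀ {i j k} → i ⊏ j → j ⊏ k → i ⊏ k
      ⊏-trans (inj₁ p) (inj₁ q) = inj₁ (<-trans p q)
      ⊏-trans (inj₁ p) (inj₂ (e , _)) = inj₁ (<-≤-trans p (≤-reflexive e))
      ⊏-trans (inj₂ (e , _)) (inj₁ q) = inj₁ (≤-<-trans (≤-reflexive e) q)
      ⊏-trans (inj₂ (e , s)) (inj₂ (e′ , s′)) = inj₂ (trans e e′ , suffix-trans s s′)

      ⊏-total : ∀ i j → i ⊏ j ⊎ i ≡ j ⊎ j ⊏ i
      ⊏-total i j with <-cmp (t (toℕ i)) (t (toℕ j)) | i Fin.≟ j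
      ... | tri< lt _ _ | _ = inj₁ (inj₁ lt)
      ... | tri> _ _ gt | _ = inj₂ (inj₂ (inj₁ gt))
      ... | tri≈ _ e _ | yes i≡j = inj₂ (inj₁ i≡j)
      ... | tri≈ _ e _ | no i≢j
        with m≤n⇒m<n∨m≡n (≤-pred (Fin.toℕ<n i)) | m≤n⇒m<n∨m≡n (≤-pred (Fin.toℕ<n j))
      ... | inj₂ i≡ | inj₂ j≡ = contradiction (Fin.toℕ-injective (trans i≡ (sym j≡))) i≢j
      ... | inj₂ i≡ | inj₁ lt = contradiction (trans (sym e) (cong t i≡)) (<⇒≢ (last _ lt))
      ... | inj₁ lt | inj₂ j≡ = contradiction (trans e (cong t j≡)) (<⇒≢ (last _ lt))
      ... | inj₁ i< | inj₁ j<
        with suffix-total M (suc (toℕ i)) (suc (toℕ j)) (m≤m+n M _) i< j<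
               (i≢j ∘ Fin.toℕ-injective ∘ suc-injective)
      ... | inj₁ s = inj₁ (inj₂ (e , s))
      ... | inj₂ s = inj₂ (inj₂ (inj₂ (sym e , s)))

      st : Permutation′ (suc M)
      st = rank _⊏_ ⊏-irrefl ⊏-trans ⊏-total

      stamp-< : ∀ {p q} → p ≤ M → q ≤ M → at p ⊏ at q → stampOf st p < stampOf st q
      stamp-< p≤ q≤ lt = subst₂ (λ x y → stampOf st x < stampOf st y) (toℕ-at p≤) (toℕ-at q≤)
        (subst₂ _<_ (sym (stampOf-value st _)) (sym (stampOf-value st _))
          (rank-mono _⊏_ ⊏-irrefl ⊏-trans ⊏-total lt))

      stamp-reflects : ∀ {p q} → p ≤ M → q ≤ M → stampOf st p < stampOf st q → at p ⊏ at q
      stamp-reflects p≤ q≤ lt = rank-reflects _⊏_ ⊏-irrefl ⊏-trans ⊏-total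
        (subst₂ _<_ (stampOf-value st _) (stampOf-value st _)
          (subst₂ (λ x y → stampOf st x < stampOf st y) (sym (toℕ-at p≤)) (sym (toℕ-at q≤)) lt))

      refine : ∀ {p q} → p ≤ M → q ≤ M → t p < t q → stampOf st p < stampOf st q
      refine p≤ q≤ lt = stamp-< p≤ q≤
        (inj₁ (subst₂ (λ x y → t x < t y) (sym (toℕ-at p≤)) (sym (toℕ-at q≤)) lt))

      suffix⇒precedes : ∀ {a b} → a ≤ M → b ≤ M → SuffixBefore c t a b → Precedes c (stampOf st) a b
      suffix⇒precedes a≤ b≤ (differ (inj₁ lt)) = inj₁ lt
      suffix⇒precedes a≤ b≤ (differ (inj₂ (e , lt))) = inj₂ (e , refine a≤ b≤ lt)
      suffix⇒precedes a≤ b≤ (agree ce te s) = inj₂ (ce , stamp-< a≤ b≤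
        (inj₂ (subst₂ (λ x y → t x ≡ t y × SuffixBefore c t (suc x) (suc y))
          (sym (toℕ-at a≤)) (sym (toℕ-at b≤)) (te , s))))

    standardise : Σ (Permutation′ (suc M)) λ s → Standardises c t s ×
      (∀ {a b} → a ≤ M → b ≤ M → SuffixBefore c t a b → Precedes c (stampOf s) a b)
    standardise = st , record { refines = refine ; ties = tie } , suffix⇒precedes
      where
      tie : ∀ {p q} → p < M → q < M → t p ≡ t q → stampOf st p < stampOf st q →
            Precedes c (stampOf st) (suc p) (suc q)
      tie {p} {q} p< q< e lt with subst₂ (λ x y → t x < t y ⊎ (t x ≡ t y × SuffixBefore c t (suc x) (suc y)))
          (toℕ-at (<⇒≤ p<)) (toℕ-at (<⇒≤ q<)) (stamp-reflects (<⇒≤ p<) (<⇒≤ q<) lt)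
      ... | inj₁ t< = contradiction e (<⇒≢ t<)
      ... | inj₂ (_ , s) = suffix⇒precedes p< q< s

    -- Unfolds `ties` letter by letter until the original letters differ.
    precedes⇒suffix : ∀ {s} → Standardises c t s →
      ∀ fuel {a b} → M ≤ fuel + a → a ≤ M → b ≤ M → Precedes c (stampOf s) a b → SuffixBefore c t a b
    precedes⇒suffix S fuel f≥ a≤ b≤ (inj₁ lt) = differ (inj₁ lt)
    precedes⇒suffix {s} S fuel {a} {b} f≥ a≤ b≤ (inj₂ (ce , lt)) with <-cmp (t a) (t b)
    ... | tri< t< _ _ = differ (inj₂ (ce , t<))
    ... | tri> _ _ t> = contradiction (refines S b≤ a≤ t>) (<⇒≯ lt)
    ... | tri≈ _ te _ with m≤n⇒m<n∨m≡n a≤ | m≤n⇒m<n∨m≡n b≤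
    ... | inj₂ refl | inj₂ refl = contradiction lt (n≮n _)
    ... | inj₂ refl | inj₁ b<   = contradiction (sym te) (<⇒≢ (last b b<))
    ... | inj₁ a<   | inj₂ refl = contradiction te (<⇒≢ (last a a<))
    precedes⇒suffix S zero f≥ a≤ b≤ (inj₂ (ce , lt)) | tri≈ _ te _ | inj₁ a< | inj₁ b< =
      contradiction a< (≤⇒≯ f≥)
    precedes⇒suffix S (suc fuel) {a} f≥ a≤ b≤ (inj₂ (ce , lt)) | tri≈ _ te _ | inj₁ a< | inj₁ b< =
      agree ce te (precedes⇒suffix S fuel (subst (M ≤_) (sym (+-suc fuel a)) f≥) a< b< (ties S a< b< te lt))

    stamp-last : ∀ {s} → Standardises c t s → stampOf s M ≡ M
    stamp-last {s} S with m≤n⇒m<n∨m≡n (placeOf-≤ s M)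
    ... | inj₂ e  = trans (cong (stampOf s) (sym e)) (stamp-place s ≤-refl)
    ... | inj₁ lt = contradiction (refines S (<⇒≤ lt) ≤-refl (last _ lt))
                      (≤⇒≯ (≤-trans (stampOf-≤ s M) (≤-reflexive (sym (stamp-place s ≤-refl)))))

  private
    monotone-≥ : ∀ (f : ℕ → ℕ) → (∀ {r r′} → r < r′ → r′ ≤ M → f r < f r′) → ∀ r → r ≤ M → r ≤ f r
    monotone-≥ f mono zero    le = z≤n
    monotone-≥ f mono (suc r) le = ≤-<-trans (monotone-≥ f mono r (<⇒≤ le)) (mono ≤-refl le)

    -- Read through `placeOf`, the hypothesis is a strictly increasing map on ranks, and such a map
    -- never falls below the identity.
    stamps-≤ : ∀ {s s′} → (∀ {p q} → p ≤ M → q ≤ M → stampOf s p < stampOf s q → stampOf s′ p < stampOf s′ q) →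
               ∀ {p} → p ≤ M → stampOf s p ≤ stampOf s′ p
    stamps-≤ {s} {s′} h {p} p≤ = subst (λ z → stampOf s p ≤ stampOf s′ z) (place-stamp s p≤)
      (monotone-≥ (λ r → stampOf s′ (placeOf s r))
        (λ r< r′≤ → h (placeOf-≤ s _) (placeOf-≤ s _)
          (subst₂ _<_ (sym (stamp-place s (≤-trans (<⇒≤ r<) r′≤))) (sym (stamp-place s r′≤)) r<))
        (stampOf s p) (stampOf-≤ s p))

    -- Induction from the end of the word: on tied stamps both permutations are governed by the
    -- following letters, whose colours agree and whose ranks are compared one place further right.
    order-preserved : ∀ {c t c′ t′ s s′} → (∀ p → p < M → t p < t M) →
      (∀ p → p ≤ M → c p ≡ c′ p × t p ≡ t′ p) →
      Standardises c t s → Standardises c′ t′ s′ →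
      ∀ {p q} → p ≤ M → q ≤ M → stampOf s p < stampOf s q → stampOf s′ p < stampOf s′ q
    order-preserved {c} {t} {c′} {t′} {s} {s′} last same S S′ p≤ q≤ lt = go M (m≤m+n M _) p≤ q≤ lt
      where
      go : ∀ fuel {p q} → M ≤ fuel + p → p ≤ M → q ≤ M → stampOf s p < stampOf s q → stampOf s′ p < stampOf s′ q
      go fuel {p} {q} f≥ p≤ q≤ lt with <-cmp (t p) (t q)
      ... | tri< t< _ _ = refines S′ p≤ q≤ (subst₂ _<_ (proj₂ (same p p≤)) (proj₂ (same q q≤)) t<)
      ... | tri> _ _ t> = contradiction (refines S q≤ p≤ t>) (<⇒≯ lt)
      ... | tri≈ _ te _ with m≤n⇒m<n∨m≡n p≤ | m≤n⇒m<n∨m≡n q≤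
      ... | inj₂ refl | inj₂ refl = contradiction lt (n≮n _)
      ... | inj₂ refl | inj₁ q<   = contradiction (sym te) (<⇒≢ (last q q<))
      ... | inj₁ p<   | inj₂ refl = contradiction te (<⇒≢ (last p p<))
      go zero f≥ p≤ q≤ lt | tri≈ _ te _ | inj₁ p< | inj₁ q< = contradiction p< (≤⇒≯ f≥)
      go (suc fuel) {p} {q} f≥ p≤ q≤ lt | tri≈ _ te _ | inj₁ p< | inj₁ q<
        with <-cmp (stampOf s′ p) (stampOf s′ q)
      ... | tri< l _ _ = l
      ... | tri≈ _ e _ = contradiction lt (<-irrefl (cong (stampOf s) (stampOf-injective s′ p≤ q≤ e)))
      ... | tri> _ _ g = contradiction
              (ties S′ q< p< (trans (sym (proj₂ (same q q≤))) (trans (sym te) (proj₂ (same p p≤)))) g)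
              (precedes-asym c′ (stampOf s′) next)
        where
        next : Precedes c′ (stampOf s′) (suc p) (suc q)
        next with ties S p< q< te lt
        ... | inj₁ c< = inj₁ (subst₂ _<_ (proj₁ (same (suc q) q<)) (proj₁ (same (suc p) p<)) c<)
        ... | inj₂ (ce , s<) = inj₂
          ( trans (sym (proj₁ (same (suc p) p<))) (trans ce (proj₁ (same (suc q) q<)))
          , go fuel (subst (M ≤_) (sym (+-suc fuel p)) f≥) p< q< s<)

  standardisation-unique : ∀ {c t c′ t′ s s′} → (∀ p → p < M → t p < t M) →
    (∀ p → p ≤ M → c p ≡ c′ p × t p ≡ t′ p) →
    Standardises c t s → Standardises c′ t′ s′ → ∀ {p} → p ≤ M → stampOf s p ≡ stampOf s′ p
  standardisation-unique {c} {t} {c′} {t′} {s} {s′} last same S S′ p≤ = ≤-antisym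
    (stamps-≤ {s} {s′} (order-preserved last same S S′) p≤)
    (stamps-≤ {s′} {s} (order-preserved last′ same′ S′ S) p≤)
    where
    same′ : ∀ p → p ≤ M → c′ p ≡ c p × t′ p ≡ t p
    same′ p le = sym (proj₁ (same p le)) , sym (proj₂ (same p le))
    last′ : ∀ p → p < M → t′ p < t′ M
    last′ p lt = subst₂ _<_ (proj₂ (same p (<⇒≤ lt))) (proj₂ (same M ≤-refl)) (last p lt)

-- Facets and their restrictions

precedes? : ∀ c s a b → Dec (Precedes c s a b)
precedes? c s a b = (c b <? c a) ⊎-dec ((c a ≟ c b) ×-dec (s a <? s b))

select : {A : Set} → (ℕ → Bool) → (ℕ → A) → ℕ → ℕ → List A
select ψ P a zero    = []
select ψ P a (suc k) = if ψ a then P a ∷ select ψ P (suc a) k else select ψ P (suc a) k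

-- Renumbers stamps when a facet is restricted to the rank set `ψ`: the stamp `r` becomes the level
-- `count ψ r`.
count : (ℕ → Bool) → ℕ → ℕ
count ψ zero    = 0
count ψ (suc r) = if ψ r then suc (count ψ r) else count ψ r

module _ (ψ : ℕ → Bool) where

  count-true : ∀ {r} → ψ r ≡ true → count ψ (suc r) ≡ suc (count ψ r)
  count-true e rewrite e = refl

  count-mono′ : ∀ {r r′} → r ≤′ r′ → count ψ r ≤ count ψ r′
  count-mono′ ≤′-refl = ≤-refl
  count-mono′ {r} (≤′-step {n = q} le) with ψ q
  ... | true  = m≤n⇒m≤1+n (count-mono′ le)
  ... | false = count-mono′ le

  count-mono : ∀ {r r′} → r ≤ r′ → count ψ r ≤ count ψ r′
  count-mono le = count-mono′ (≤⇒≤′ le)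

  count-reflects-< : ∀ {r r′} → count ψ r < count ψ r′ → r < r′
  count-reflects-< lt = ≰⇒> (λ le → contradiction (count-mono le) (<⇒≱ lt))

  -- No stamps are merged across a selected rank, so there the face and the facet have the same
  -- blocks.
  count-<ᵇ : ∀ {a} → ψ a ≡ true → ∀ r → (r <ᵇ suc a) ≡ (count ψ r <ᵇ suc (count ψ a))
  count-<ᵇ {a} e r with r ≤? a
  ... | yes le = trans (<ᵇ-true (s≤s le)) (sym (<ᵇ-true (s≤s (count-mono le))))
  ... | no ¬le = trans (<ᵇ-false (≰⇒> ¬le))
                   (sym (<ᵇ-false (subst (_≤ count ψ r) (count-true e) (count-mono (≰⇒> ¬le)))))

  count-const : ∀ {r r′} → count ψ r ≡ count ψ r′ → ∀ q → r ≤ q → q < r′ → ψ q ≡ false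
  count-const {r} {r′} e q rq qr′ with ψ q in eq
  ... | false = refl
  ... | true  = contradiction e (<⇒≢ (≤-<-trans (count-mono rq)
                  (subst (_≤ count ψ r′) (count-true eq) (count-mono qr′))))

module Facets (K : ℕ) (col : Fin (suc (suc K)) → ℕ) where

  private
    M : ℕ
    M = suc K

  Perm : Set
  Perm = Permutation′ (suc M)

  colours : Perm → ℕ → ℕ
  colours π p = col (element M π p)

  colours-position : ∀ π e → colours π (position M π e) ≡ col e
  colours-position π e = cong col (element-position M π e)

  partitionAt : Perm → Perm → ℕ → Partition (suc M)
  partitionAt π s r = record
    { rel = λ e f → b e ≡ᵇ b f
    ; relRefl = λ e → ≡ᵇ-true {b e} refl
    ; relSym = λ e f eq → ≡ᵇ-true (sym (≡ᵇ-sound (b e) (b f) eq))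
    ; relTrans = λ e f g eq eq′ → ≡ᵇ-true (trans (≡ᵇ-sound (b e) (b f) eq) (≡ᵇ-sound (b f) (b g) eq′)) }
    where
    b : Fin (suc M) → ℕ
    b e = block (stampOf M s) (suc r) (position M π e)

  -- The ranks a face must keep: omitting such an `r` ties the stamps `r` and `suc r`, and breaking
  -- the tie by suffixes would not restore their order.
  descent : Perm → Perm → ℕ → Bool
  descent π s r =
    not (does (precedes? (colours π) (stampOf M s) (suc (placeOf M s r)) (suc (placeOf M s (suc r)))))

  no-descent : ∀ π s {r} → descent π s r ≡ false →
    Precedes (colours π) (stampOf M s) (suc (placeOf M s r)) (suc (placeOf M s (suc r)))
  no-descent π s {r} = witness (precedes? (colours π) (stampOf M s) (suc (placeOf M s r)) (suc (placeOf M s (suc r))))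
    where
    witness : ∀ {P : Set} (d : Dec P) → not (does d) ≡ false → P
    witness (yes p) _ = p

  precedes⇒no-descent : ∀ π s {r} →
    Precedes (colours π) (stampOf M s) (suc (placeOf M s r)) (suc (placeOf M s (suc r))) →
    descent π s r ≡ false
  precedes⇒no-descent π s {r} = falsify (precedes? (colours π) (stampOf M s) (suc (placeOf M s r)) (suc (placeOf M s (suc r))))
    where
    falsify : ∀ {P : Set} (d : Dec P) → P → not (does d) ≡ false
    falsify d p = cong not (dec-true d p)

  module Stamps (s : Perm) (s-last : stampOf M s M ≡ M) where

    stamp-inner : ∀ {p} → p < M → stampOf M s p ≤ K
    stamp-inner {p} lt with m≤n⇒m<n∨m≡n (stampOf-≤ M s p)
    ... | inj₁ l = ≤-pred l
    ... | inj₂ e = contradiction (stampOf-injective M s (<⇒≤ lt) ≤-refl (trans e (sym s-last))) (<⇒≢ lt)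

    place-last : placeOf M s M ≡ M
    place-last = trans (cong (placeOf M s) (sym s-last)) (place-stamp M s ≤-refl)

    place-inner : ∀ {r} → r ≤ K → placeOf M s r < M
    place-inner {r} le = ≤∧≢⇒< (placeOf-≤ M s r) λ e →
      <⇒≢ (s≤s le) (trans (sym (stamp-place M s (m≤n⇒m≤1+n le))) (trans (cong (stampOf M s) e) s-last))

  -- A sorted word with distinct stamps together with a placement `π` of the elements. Several
  -- facets can have the same word; these represent one orbit.
  record Facet : Set where
    field
      π      : Perm
      s      : Perm
      s-last : stampOf M s M ≡ M
      sorted : SiblingsSorted M (stampOf M s) (Precedes (colours π) (stampOf M s))

  -- The rank `K` belongs to `1̂`, which is not listed in `x` but is a level of its word; hence
  -- `ψ-top`.
  record Matches (x : List (Partition (suc M))) (π s σ : Perm) (ψ : ℕ → Bool) : Set where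
    field
      ψ-top   : ψ K ≡ true
      descent⊆ψ : ∀ r → r < K → descent π s r ≡ true → ψ r ≡ true
      pointwise : Pointwise (Sends σ) x (select ψ (partitionAt π s) 0 K)

  -- Computed from the chain alone, so that all facets matching `x` can be compared through it. The
  -- element `zero` is arbitrary, `1̂` having a single block.
  topCode : List (Partition (suc M)) → ℕ
  topCode x = codeStep 1̂ (foldl (λ g u → codeStep u g) col x) zero

  module Word (x : List (Partition (suc M))) (F : Facet) (σ : Perm)
    (young : ∀ e → col (σ ⟨$⟩ʳ e) ≡ col e) (ψ : ℕ → Bool) (m : Matches x (Facet.π F) (Facet.s F) σ ψ) where

    open Facet F
    open Matches m
    open Stamps s s-last

    private
      P : ℕ → Partition (suc M)
      P = partitionAt π s

      c : ℕ → ℕ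
      c = colours π

      π′ : Perm
      π′ = σ ∘ₚ π

    t : ℕ → ℕ
    t p = count ψ (stampOf M s p)

    t-inner : ∀ p → p < M → t p < suc (count ψ K)
    t-inner p lt = s≤s (count-mono ψ (stamp-inner lt))

    t-top : t M ≡ suc (count ψ K)
    t-top = trans (cong (count ψ) s-last) (count-true ψ ψ-top)

    last : ∀ p → p < M → t p < t M
    last p lt = subst (t p <_) (sym t-top) (t-inner p lt)

    length-x : length x ≡ count ψ K
    length-x = sym (trans (walk 0 K x (+-identityʳ K) pointwise) (+-identityʳ (length x)))
      where
      walk : ∀ a k xs → k + a ≡ K → Pointwise (Sends σ) xs (select ψ P a k) →
             count ψ K ≡ length xs + count ψ a
      walk a zero [] refl [] = refl
      walk a (suc k) xs e pw with ψ a in ψa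
      walk a (suc k) (u ∷ xs) e (_ ∷ pw) | true =
        trans (walk (suc a) k xs (trans (+-suc k a) e) pw)
          (trans (cong (length xs +_) (count-true ψ ψa)) (+-suc (length xs) (count ψ a)))
      ... | false = trans (walk (suc a) k xs (trans (+-suc k a) e) pw)
          (cong (λ b → length xs + (if b then suc (count ψ a) else count ψ a)) ψa)

    opaque
      -- Stamps merged by `ψ` have only unselected ranks from the smaller up to the larger. None of
      -- these is a descent, so the tie condition follows by transitivity along them.
      standardises : Standardises M c t s
      standardises = record
        { refines = λ _ _ → count-reflects-< ψ
        ; ties = λ {p} {q} p< q< e lt → subst₂ (λ a b → Precedes c (stampOf M s) (suc a) (suc b))
            (place-stamp M s (<⇒≤ p<)) (place-stamp M s (<⇒≤ q<))
            (climb (<⇒<′ lt) (stamp-inner q<) (λ r pr rq → count-const ψ e r pr rq)) }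
        where
        climb : ∀ {r r′} → r <′ r′ → r′ ≤ K → (∀ q → r ≤ q → q < r′ → ψ q ≡ false) →
                Precedes c (stampOf M s) (suc (placeOf M s r)) (suc (placeOf M s r′))
        step : ∀ {r} → r < K → ψ r ≡ false →
                Precedes c (stampOf M s) (suc (placeOf M s r)) (suc (placeOf M s (suc r)))
        step {r} lt e with descent π s r in d
        ... | false = no-descent π s d
        ... | true  = contradiction (trans (sym e) (descent⊆ψ r lt d)) λ ()
        climb {r} ≤′-refl le h = step le (h r ≤-refl ≤-refl)
        climb {r} (≤′-step {n = q} lt) le h = precedes-trans c (stampOf M s)
          (climb lt (<⇒≤ le) (λ i ri iq → h i ri (m<n⇒m<1+n iq)))
          (step le (h q (<⇒≤ (≤′⇒≤ lt)) ≤-refl))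

      -- Sortedness passes from the facet to the merged stamps by `sorted-coarsen`, then from single
      -- letters to suffixes, and then to codes.
      good : ∀ v → Codes.Good (suc M) c t v
      good = sorted⇒good M c t (SuffixBefore c t) last (differ ∘ inj₁) (λ e lt → differ (inj₂ (e , lt)))
        agree suffix-asym
        (λ a b a≤b b<M st ins → precedes⇒suffix M last standardises M (m≤m+n M a)
          (≤-trans a≤b (<⇒≤ b<M)) b<M
          (sorted-coarsen M (stampOf M s) t (Precedes c (stampOf M s))
            (λ p< q< → Standardises.refines standardises (<⇒≤ p<) (<⇒≤ q<))
            (precedes-asym c (stampOf M s)) (Standardises.ties standardises) sorted a b a≤b b<M st ins))

      block≡ : ∀ {a} → ψ a ≡ true → ∀ p → block (stampOf M s) (suc a) p ≡ block t (suc (count ψ a)) p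
      block≡ ψa p = block-cong p (λ r _ → count-<ᵇ ψ ψa (stampOf M s r))

      realises : Realises M π′ t 0 (x ++ 1̂ ∷ [])
      realises = walk 0 K x (+-identityʳ K) pointwise
        where
        walk : ∀ a k xs → k + a ≡ K → Pointwise (Sends σ) xs (select ψ P a k) →
               Realises M π′ t (count ψ a) (xs ++ 1̂ ∷ [])
        walk a zero [] refl [] = (λ e f → sym (≡ᵇ-true (trans (sym (whole e)) (whole f)))) , tt
          where
          whole : ∀ e → block t (suc (count ψ K)) 0 ≡ block t (suc (count ψ K)) (position M π′ e)
          whole e = block-join t _ (≤⇒≤′ z≤n)
            (λ r _ lt → t-inner r (<-≤-trans lt (position-bound M π′ e)))
        walk a (suc k) xs e pw with ψ a in ψa
        walk a (suc k) (u ∷ xs) e (sends ∷ pw) | true =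
          (λ f g → trans (sym (sends f g)) (cong₂ _≡ᵇ_ (block≡ ψa (position M π′ f)) (block≡ ψa (position M π′ g)))) ,
          subst (λ i → Realises M π′ t i (xs ++ 1̂ ∷ [])) (count-true ψ ψa)
            (walk (suc a) k xs (trans (+-suc k a) e) pw)
        ... | false = subst (λ i → Realises M π′ t i (xs ++ 1̂ ∷ []))
            (cong (λ b → if b then suc (count ψ a) else count ψ a) ψa)
            (walk (suc a) k xs (trans (+-suc k a) e) pw)

      -- The Young condition enters here: `σ` preserves colours, which are the codes at level `0`.
      code : Codes.wcode (suc M) c t (suc (length x)) 0 ≡ topCode x
      code = subst₂ (λ v p → wcode v p ≡ topCode x)
        (trans (+-identityʳ _) (trans (length-++ x) (+-comm (length x) 1)))
        (position-element M π′ z<s)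
        (trans (code-realised M π′ c t 0 (x ++ 1̂ ∷ []) col realises
                 (λ e → trans (colours-position π (σ ⟨$⟩ʳ e)) (young e)) (element M π′ 0))
               (cong (λ g → g (element M π′ 0)) (foldl-++ (λ g u → codeStep u g) col x (1̂ ∷ []))))
        where open Codes (suc M) c t

  SameWord : Facet → Facet → Set
  SameWord F F′ = ∀ p → p ≤ M → colours (Facet.π F) p ≡ colours (Facet.π F′) p ×
                                stampOf M (Facet.s F) p ≡ stampOf M (Facet.s F′) p

  module _ {x : List (Partition (suc M))} (F F′ : Facet) (σ σ′ : Perm)
    (young  : ∀ e → col (σ ⟨$⟩ʳ e) ≡ col e) (young′ : ∀ e → col (σ′ ⟨$⟩ʳ e) ≡ col e)
    {ψ ψ′ : ℕ → Bool}
    (m : Matches x (Facet.π F) (Facet.s F) σ ψ) (m′ : Matches x (Facet.π F′) (Facet.s F′) σ′ ψ′) where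

    private
      module W  = Word x F σ young ψ m
      module W′ = Word x F′ σ′ young′ ψ′ m′

    -- Both merged words are good and have the code `topCode x`, so they coincide; the stamps of the
    -- two facets both standardise this word, so they coincide as well.
    matches-unique : SameWord F F′
    matches-unique p p≤ = proj₁ (word p p≤) ,
      standardisation-unique M W.last word W.standardises W′.standardises p≤
      where
      V : ℕ
      V = suc (length x)
      inner-word : ∀ j → j ≤ M → colours (Facet.π F) j ≡ colours (Facet.π F′) j × (j < M → W.t j ≡ W′.t j)
      inner-word = good-word-unique M V
        (λ q lt → subst (λ z → W.t q < suc z) (sym W.length-x) (W.t-inner q lt))
        (≤-reflexive (trans (cong suc W.length-x) (sym W.t-top)))
        (λ q lt → subst (λ z → W′.t q < suc z) (sym W′.length-x) (W′.t-inner q lt))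
        (≤-reflexive (trans (cong suc W′.length-x) (sym W′.t-top)))
        (λ v _ → W.good v) (λ v _ → W′.good v) (trans W.code (sym W′.code))
      word : ∀ j → j ≤ M → colours (Facet.π F) j ≡ colours (Facet.π F′) j × W.t j ≡ W′.t j
      word j j≤ with m≤n⇒m<n∨m≡n j≤
      ... | inj₁ lt   = proj₁ (inner-word j j≤) , proj₂ (inner-word j j≤) lt
      ... | inj₂ refl = proj₁ (inner-word j j≤) ,
        trans W.t-top (trans (cong suc (trans (sym W.length-x) W′.length-x)) (sym W′.t-top))

  closed-chain : ∀ {x : List (Partition (suc M))} → IsChain x → Linked _<P_ (0̂ ∷ x ++ 1̂ ∷ [])
  closed-chain {[]} _ =
    ((λ _ _ _ → refl) , λ le → contradiction (le zero (suc zero) refl) λ ()) ∷ [-]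
  closed-chain {u ∷ us} (proper , linked) = proj₁ (All.head proper) ∷ close proper linked
    where
    close : ∀ {u us} → All IsProper (u ∷ us) → Linked _<P_ (u ∷ us) → Linked _<P_ (u ∷ us ++ 1̂ ∷ [])
    close (p ∷ []) [-] = proj₂ p ∷ [-]
    close (_ ∷ ps) (l ∷ ls) = l ∷ close ps ls

  arrangeChain : ∀ {x} → IsChain x → Arrangement M col x
  arrangeChain {x} chain = arrange M col x (closed-chain chain)

  -- Each of the `suc (length x)` levels occurs as a stamp at one of `M` positions.
  chain-length : ∀ {x : List (Partition (suc M))} → IsChain x → length x ≤ K
  chain-length {x} chain = ≤-pred (Fin.injective⇒≤ place-injective)
    where
    open Arrangement (arrangeChain chain)
    found : ∀ (i : Fin (suc (length x))) → ∃[ p ] (p < M × t p ≡ toℕ i)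
    found i = attained (toℕ i) (≤-pred (Fin.toℕ<n i))
    place : Fin (suc (length x)) → Fin M
    place i = fromℕ< (proj₁ (proj₂ (found i)))
    place-injective : ∀ {i j} → place i ≡ place j → i ≡ j
    place-injective {i} {j} e = Fin.toℕ-injective
      (trans (sym (proj₂ (proj₂ (found i))))
        (trans (cong t (Fin.fromℕ<-injective _ _ _ _ e)) (proj₂ (proj₂ (found j)))))

  module Cover {x : List (Partition (suc M))} (chain : IsChain x) where

    open Arrangement (arrangeChain chain)

    private
      c : ℕ → ℕ
      c = colours π

      last : ∀ p → p < M → t p < t M
      last p lt = subst (t p <_) (sym t-last) (s≤s (t-bound p lt))

      standard = standardise M {c} {t} last

      s : Perm
      s = proj₁ standard

      S : Standardises M c t s
      S = proj₁ (proj₂ standard)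

      sorted : SiblingsSorted M (stampOf M s) (Precedes c (stampOf M s))
      sorted = sorted-refine M (stampOf M s) t (Precedes c (stampOf M s))
        (λ p< q< → Standardises.refines S (<⇒≤ p<) (<⇒≤ q<))
        (λ a b a≤b b<M st ins → proj₂ (proj₂ standard) (≤-trans a≤b (<⇒≤ b<M)) b<M
          (good⇒sorted M c t (SuffixBefore c t) last (differ ∘ inj₁) (λ e lt → differ (inj₂ (e , lt))) agree
            (suc (length x)) (λ p lt → s≤s (t-bound p lt)) good a b a≤b b<M st ins))

    facet : Facet
    facet = record { π = π ; s = s ; s-last = stamp-last M last S ; sorted = sorted }

    open Stamps s (Facet.s-last facet)

    -- A rank is selected where the original stamp grows on passing to the next rank; at `K` the
    -- next one is the closing stamp.
    ψ : ℕ → Bool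
    ψ r = t (placeOf M s r) <ᵇ t (placeOf M s (suc r))

    private
      P : ℕ → Partition (suc M)
      P = partitionAt π s

      g : ℕ → ℕ
      g r = t (placeOf M s r)

      coarse : ∀ {p q} → p ≤ M → q ≤ M → stampOf M s p ≤ stampOf M s q → t p ≤ t q
      coarse p≤ q≤ le = ≮⇒≥ (λ lt → contradiction (Standardises.refines S q≤ p≤ lt) (≤⇒≯ le))

      ≤-g : ∀ {p r} → p ≤ M → r ≤ M → stampOf M s p ≤ r → t p ≤ g r
      ≤-g {p} p≤ r≤ le = coarse p≤ (placeOf-≤ M s _) (subst (stampOf M s p ≤_) (sym (stamp-place M s r≤)) le)

      g-≤ : ∀ {p r} → p ≤ M → r ≤ M → r ≤ stampOf M s p → g r ≤ t p
      g-≤ {p} p≤ r≤ le = coarse (placeOf-≤ M s _) p≤ (subst (_≤ stampOf M s p) (sym (stamp-place M s r≤)) le)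

      g-bound : ∀ {r} → r ≤ K → g r ≤ length x
      g-bound le = t-bound _ (place-inner le)

      -- A larger jump would skip a level, but every level is attained.
      g-step : ∀ {r} → suc r ≤ K → g (suc r) ≤ suc (g r)
      g-step {r} r< with g (suc r) ≤? suc (g r)
      ... | yes le = le
      ... | no ¬le with attained (suc (g r)) (≤-trans (<⇒≤ (≰⇒> ¬le)) (g-bound r<))
      ... | p , p< , e with stampOf M s p ≤? r
      ... | yes le = contradiction (≤-g (<⇒≤ p<) (m≤n⇒m≤1+n (<⇒≤ r<)) le)
                       (<⇒≱ (≤-reflexive (sym e)))
      ... | no ¬le′ = contradiction (g-≤ (<⇒≤ p<) (m≤n⇒m≤1+n r<) (≰⇒> ¬le′))
                       (<⇒≱ (subst (_< g (suc r)) (sym e) (≰⇒> ¬le)))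

      g-0 : g 0 ≡ 0
      g-0 with attained 0 z≤n
      ... | p , p< , e = n≤0⇒n≡0 (subst (g 0 ≤_) e (g-≤ (<⇒≤ p<) z≤n z≤n))

      g-K : g K ≡ length x
      g-K with attained (length x) ≤-refl
      ... | p , p< , e = ≤-antisym (g-bound ≤-refl)
              (subst (_≤ g K) e (≤-g (<⇒≤ p<) (n≤1+n K) (stamp-inner p<)))

      ψ-false : ∀ {r} → suc r ≤ M → ψ r ≡ false → g (suc r) ≡ g r
      ψ-false {r} r< e = ≤-antisym
        (≮⇒≥ (λ lt → contradiction (trans (sym e) (<ᵇ-true lt)) λ ()))
        (g-≤ (placeOf-≤ M s _) (<⇒≤ r<) (subst (r ≤_) (sym (stamp-place M s r<)) (n≤1+n r)))

      ψ-true : ∀ {r} → suc r ≤ K → ψ r ≡ true → g (suc r) ≡ suc (g r)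
      ψ-true {r} r< e = ≤-antisym (g-step r<)
        (≰⇒> (λ le → contradiction (trans (sym e) (<ᵇ-false le)) λ ()))


      walk : ∀ a k xs → k + a ≡ K → length xs + g a ≡ length x → Realises M π t (g a) (xs ++ 1̂ ∷ []) →
             Pointwise (Sends Perm.id) xs (select ψ P a k)
      walk a zero [] refl _ _ = []
      walk a zero (u ∷ xs) refl e _ = contradiction (trans g-K (sym e)) (m≢1+n+m (g a))
      walk a (suc k) xs ka e real with ψ a in ψa
      ... | false = walk (suc a) k xs (trans (+-suc k a) ka)
              (trans (cong (length xs +_) same) e)
              (subst (λ i → Realises M π t i (xs ++ 1̂ ∷ [])) (sym same) real)
        where
        same : g (suc a) ≡ g a
        same = ψ-false (s≤s (subst (a ≤_) ka (m≤n+m a (suc k)))) ψa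
      walk a (suc k) [] ka e real | true =
        contradiction (subst (_≤ length x) (ψ-true a<K ψa) (g-bound a<K))
          (<⇒≱ (s≤s (≤-reflexive (sym e))))
        where
        a<K : suc a ≤ K
        a<K = subst (suc a ≤_) (trans (+-suc k a) ka) (m≤n+m (suc a) k)
      walk a (suc k) (u ∷ xs) ka e (real , reals) | true = head ∷ walk (suc a) k xs (trans (+-suc k a) ka)
          (trans (cong (length xs +_) (ψ-true a<K ψa)) (trans (+-suc (length xs) (g a)) e))
          (subst (λ i → Realises M π t i (xs ++ 1̂ ∷ [])) (sym (ψ-true a<K ψa)) reals)
        where
        a<K : suc a ≤ K
        a<K = subst (suc a ≤_) (trans (+-suc k a) ka) (m≤n+m (suc a) k)
        levels : ∀ r → r < M → (stampOf M s r <ᵇ suc a) ≡ (t r <ᵇ suc (g a))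
        levels r r< with stampOf M s r ≤? a
        ... | yes le = trans (<ᵇ-true (s≤s le))
                (sym (<ᵇ-true (s≤s (≤-g (<⇒≤ r<) (m≤n⇒m≤1+n (<⇒≤ a<K)) le))))
        ... | no ¬le = trans (<ᵇ-false (≰⇒> ¬le))
                (sym (<ᵇ-false (subst (_≤ t r) (ψ-true a<K ψa) (g-≤ (<⇒≤ r<) (m≤n⇒m≤1+n a<K) (≰⇒> ¬le)))))
        block≡ : ∀ f → block (stampOf M s) (suc a) (position M π f) ≡ block t (suc (g a)) (position M π f)
        block≡ f = block-cong (position M π f) (λ r lt → levels r (<-≤-trans lt (position-bound M π f)))
        head : Sends Perm.id u (P a)
        head f h = trans (cong₂ _≡ᵇ_ (block≡ f) (block≡ h)) (sym (real f h))

    opaque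
      matches : Matches x π s Perm.id ψ
      matches = record
        { ψ-top = <ᵇ-true (subst (g K <_) (cong t (sym place-last)) (last _ (place-inner ≤-refl)))
        ; descent⊆ψ = descends
        ; pointwise = walk 0 K x (+-identityʳ K) (trans (cong (length x +_) g-0) (+-identityʳ _))
            (subst (λ i → Realises M π t i (x ++ 1̂ ∷ [])) (sym g-0) realises) }
        where
        descends : ∀ r → r < K → descent π s r ≡ true → ψ r ≡ true
        descends r r< d with ψ r in ψr
        ... | true  = refl
        -- At an unselected rank the two stamps were tied, and standardisation ordered them by what
        -- follows.
        ... | false = contradiction (trans (sym d) (precedes⇒no-descent π s
                (Standardises.ties S (place-inner (<⇒≤ r<)) (place-inner r<) (sym (ψ-false (m≤n⇒m≤1+n r<) ψr))
                  (subst₂ _<_ (sym (stamp-place M s (m≤n⇒m≤1+n (<⇒≤ r<)))) (sym (stamp-place M s (m≤n⇒m≤1+n r<)))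
                    ≤-refl)))) λ ()

-- Sublists given by sets of ranks

always : ℕ → Bool
always _ = true

module _ {A : Set} {P : ℕ → A} where

  select-All : ∀ {Q : A → Set} ψ a k → (∀ r → a ≤ r → r < k + a → Q (P r)) → All Q (select ψ P a k)
  select-All ψ a zero h = []
  select-All ψ a (suc k) h with select-All ψ (suc a) k (λ r le lt → h r (<⇒≤ le) (subst (r <_) (+-suc k a) lt)) | ψ a
  ... | rest | true  = h a ≤-refl (s≤s (m≤n+m a k)) ∷ rest
  ... | rest | false = rest

  select-AllPairs : ∀ {R : A → A → Set} ψ a k → (∀ r r′ → r < r′ → r′ < k + a → R (P r) (P r′)) →
                    AllPairs R (select ψ P a k)
  select-AllPairs ψ a zero h = []
  select-AllPairs {R} ψ a (suc k) h
    with select-AllPairs {R} ψ (suc a) k (λ r r′ lt le → h r r′ lt (subst (r′ <_) (+-suc k a) le)) | ψ a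
  ... | rest | true  = select-All ψ (suc a) k (λ r le lt → h a r le (subst (r <_) (+-suc k a) lt)) ∷ rest
  ... | rest | false = rest

  select-Any⁺ : ∀ {Q : A → Set} ψ a k {r} → a ≤ r → r < k + a → ψ r ≡ true → Q (P r) → Any Q (select ψ P a k)
  select-Any⁺ ψ a zero le lt e q = contradiction le (<⇒≱ lt)
  select-Any⁺ ψ a (suc k) {r} le lt e q with m≤n⇒m<n∨m≡n le
  ... | inj₂ refl rewrite e = here q
  ... | inj₁ a<r with select-Any⁺ ψ (suc a) k a<r (subst (r <_) (sym (+-suc k a)) lt) e q | ψ a
  ... | rest | true  = there rest
  ... | rest | false = rest

  select-Any⁻ : ∀ {Q : A → Set} ψ a k → Any Q (select ψ P a k) →
                ∃[ r ] (r < k + a × ψ r ≡ true × Q (P r))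
  select-Any⁻ ψ a (suc k) any with ψ a in e
  select-Any⁻ ψ a (suc k) (here q) | true = a , s≤s (m≤n+m a k) , e , q
  select-Any⁻ ψ a (suc k) (there any) | true with select-Any⁻ ψ (suc a) k any
  ... | r , lt , rest = r , subst (r <_) (+-suc k a) lt , rest
  select-Any⁻ ψ a (suc k) any | false with select-Any⁻ ψ (suc a) k any
  ... | r , lt , rest = r , subst (r <_) (+-suc k a) lt , rest

  select-cong : ∀ {ψ ψ′} a k → (∀ r → a ≤ r → ψ r ≡ ψ′ r) → select ψ P a k ≡ select ψ′ P a k
  select-cong a zero h = refl
  select-cong a (suc k) h = cong₂ (λ b xs → if b then P a ∷ xs else xs) (h a ≤-refl)
    (select-cong (suc a) k (λ r le → h r (<⇒≤ le)))

  length-select-always : ∀ a k → length (select always P a k) ≡ k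
  length-select-always a zero    = refl
  length-select-always a (suc k) = cong suc (length-select-always (suc a) k)

  select-Sublist : ∀ {B : Set} {R : B → A → Set} {xs} ψ a k →
    Pointwise R xs (select ψ P a k) → Sublist R xs (select always P a k)
  select-Sublist ψ a zero [] = []
  select-Sublist ψ a (suc k) pw with ψ a
  select-Sublist ψ a (suc k) (r ∷ pw) | true = r ∷ select-Sublist ψ (suc a) k pw
  ... | false = P a ∷ʳ select-Sublist ψ (suc a) k pw

  select-restrict : ∀ {B : Set} {R : B → A → Set} {R′ : A → B → Set} {xs} χ ψ a k →
    (∀ r → r < k + a → χ r ≡ true → ψ r ≡ true) → (∀ {u v} → R u v → R′ v u) →
    Pointwise R xs (select ψ P a k) → Sublist R′ (select χ P a k) xs
  select-restrict χ ψ a zero h conv [] = []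
  select-restrict {R = R} {R′} {xs} χ ψ a (suc k) h conv pw with χ a in χa | ψ a in ψa
  select-restrict {xs = u ∷ xs} χ ψ a (suc k) h conv (r ∷ pw) | true | true =
    conv r ∷ select-restrict χ ψ (suc a) k (λ r lt → h r (subst (r <_) (+-suc k a) lt)) conv pw
  select-restrict {xs = u ∷ xs} χ ψ a (suc k) h conv (r ∷ pw) | false | true =
    u ∷ʳ select-restrict χ ψ (suc a) k (λ r lt → h r (subst (r <_) (+-suc k a) lt)) conv pw
  ... | false | false =
    select-restrict χ ψ (suc a) k (λ r lt → h r (subst (r <_) (+-suc k a) lt)) conv pw
  ... | true | false =
    contradiction (trans (sym ψa) (h a (s≤s (m≤n+m a k)) χa)) λ ()

  -- The value at `k + a`, just past the listed ranks, is fixed because `ψ-top` asks for it; the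
  -- base case supplies it through `always`.
  Sublist⇒select : ∀ {B : Set} {R : B → A → Set} {xs} a k → Sublist R xs (select always P a k) →
    ∃[ ψ ] (ψ (k + a) ≡ true × Pointwise R xs (select ψ P a k))
  Sublist⇒select a zero [] = always , refl , []
  Sublist⇒select {R = R} a (suc k) sub = cases sub
    where
    update : (ℕ → Bool) → Bool → ℕ → Bool
    update ψ b r = if r ≡ᵇ a then b else ψ r
    update-other : ∀ ψ b r → suc a ≤ r → update ψ b r ≡ ψ r
    update-other ψ b r le rewrite ≡ᵇ-false (λ e → <⇒≢ le (sym e)) = refl
    update-at : ∀ ψ b → update ψ b a ≡ b
    update-at ψ b rewrite ≡ᵇ-true {a} refl = refl
    top : ∀ ψ b → ψ (k + suc a) ≡ true → update ψ b (suc k + a) ≡ true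
    top ψ b e = trans (update-other ψ b (suc k + a) (s≤s (m≤n+m a k))) (trans (cong ψ (sym (+-suc k a))) e)
    cases : ∀ {xs} → Sublist R xs (P a ∷ select always P (suc a) k) →
            ∃[ ψ ] (ψ (suc k + a) ≡ true × Pointwise R xs (select ψ P a (suc k)))
    cases (r ∷ sub) with Sublist⇒select (suc a) k sub
    ... | ψ , ψt , pw = update ψ true , top ψ true ψt ,
      subst (Pointwise R _) (cong₂ (λ b ys → if b then P a ∷ ys else ys) (sym (update-at ψ true))
        (sym (select-cong (suc a) k (update-other ψ true)))) (r ∷ pw)
    cases (_ ∷ʳ sub) with Sublist⇒select (suc a) k sub
    ... | ψ , ψt , pw = update ψ false , top ψ false ψt ,
      subst (Pointwise R _) (cong₂ (λ b ys → if b then P a ∷ ys else ys) (sym (update-at ψ false))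
        (sym (select-cong (suc a) k (update-other ψ false)))) pw

-- Permutations acting on partitions

module _ {n : ℕ} where

  ind : Bool → ℕ
  ind b = if b then 1 else 0

  -- Stands in for the rank function: invariant under permutations and strictly increasing along a
  -- chain.
  pairs : Partition n → ℕ
  pairs u = sum (λ i → sum (λ j → ind (rel u i j)))

  pairs-invariant : ∀ {σ u v} → Sends σ u v → pairs u ≡ pairs v
  pairs-invariant {σ} {u} {v} sends = sym (trans (sum-permute (λ i → sum (λ j → ind (rel v i j))) σ)
    (sum-cong-≗ λ i → trans (sum-permute (λ j → ind (rel v (σ ⟨$⟩ʳ i) j)) σ)
      (sum-cong-≗ λ j → cong ind (sends i j))))

  pairs-mono : ∀ {u v : Partition n} → u ≤P v → ∀ e f → rel u e f ≡ false → rel v e f ≡ true →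
               pairs u < pairs v
  pairs-mono {u} {v} le e f ru rv = sum-mono-< (λ i → sum-mono-≤ (λ j → entry i j)) e
    (sum-mono-< (λ j → entry e j) f (subst₂ (λ a b → ind a < ind b) (sym ru) (sym rv) z<s))
    where
    entry : ∀ i j → ind (rel u i j) ≤ ind (rel v i j)
    entry i j with rel u i j in r
    ... | false = z≤n
    ... | true rewrite le i j r = ≤-refl

  sends-inverse : ∀ {σ} {u v : Partition n} → Sends σ u v → Sends (flip σ) v u
  sends-inverse {σ} {u} {v} h i j = trans (sym (h (σ ⟨$⟩ˡ i) (σ ⟨$⟩ˡ j)))
    (cong₂ (rel v) (inverseʳ σ) (inverseʳ σ))

  sends-id⇒≈ : ∀ {u v : Partition n} → Sends Perm.id u v → u ≈P v
  sends-id⇒≈ h = (λ i j e → trans (h i j) e) , (λ i j e → trans (sym (h i j)) e)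

-- Cells of the quotient complex

module Orbits (K : ℕ) (col : Fin (suc (suc K)) → ℕ) where

  open Facets K col

  private
    M : ℕ
    M = suc K

  cell : (ℕ → Bool) → Perm → Perm → List (Partition (suc M))
  cell ψ π s = select ψ (partitionAt π s) 0 K

  module _ (π s : Perm) (s-last : stampOf M s M ≡ M) where

    open Stamps s s-last

    private
      P : ℕ → Partition (suc M)
      P = partitionAt π s

      weaken : ∀ {r r′} → r ≤ r′ → ∀ {p q} → p ≤ q →
               block (stampOf M s) (suc r) p ≡ block (stampOf M s) (suc r) q →
               block (stampOf M s) (suc r′) p ≡ block (stampOf M s) (suc r′) q
      weaken {r} {r′} le pq e = block-join (stampOf M s) (suc r′) (≤⇒≤′ pq)
        (λ i pi iq → <-≤-trans (block-≡⇒inside (stampOf M s) (suc r) pi iq e) (s≤s le))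

      b : ℕ → Fin (suc M) → ℕ
      b r e = block (stampOf M s) (suc r) (position M π e)

    partition-mono : ∀ {r r′} → r ≤ r′ → P r ≤P P r′
    partition-mono {r} {r′} le e f eq with ≤-total (position M π e) (position M π f)
    ... | inj₁ pq = ≡ᵇ-true {b r′ e} {b r′ f} (weaken le pq (≡ᵇ-sound (b r e) (b r f) eq))
    ... | inj₂ qp = ≡ᵇ-true {b r′ e} {b r′ f} (sym (weaken le qp (sym (≡ᵇ-sound (b r e) (b r f) eq))))

    module _ {r : ℕ} (r≤K : r ≤ K) where

      private
        p : ℕ
        p = placeOf M s r

        p<M : p < M
        p<M = place-inner r≤K

        stamp-p : stampOf M s p ≡ r
        stamp-p = stamp-place M s (m≤n⇒m≤1+n r≤K)

      left right : Fin (suc M)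
      left  = element M π p
      right = element M π (suc p)

      position-left : position M π left ≡ p
      position-left = position-element M π (m<n⇒m<1+n p<M)

      position-right : position M π right ≡ suc p
      position-right = position-element M π (s≤s p<M)

      left≢right : left ≢ right
      left≢right e = 1+n≢n (trans (sym position-right) (trans (cong (position M π) (sym e)) position-left))

      private
        block-left : ∀ r′ → b r′ left ≡ block (stampOf M s) (suc r′) p
        block-left r′ = cong (block (stampOf M s) (suc r′)) position-left

        block-right : ∀ r′ → b r′ right ≡ block (stampOf M s) (suc r′) (suc p)
        block-right r′ = cong (block (stampOf M s) (suc r′)) position-right

      joined : ∀ {r′} → r ≤ r′ → rel (P r′) left right ≡ true
      joined {r′} le = ≡ᵇ-true {b r′ left} {b r′ right} (trans (block-left r′) (trans
        (sym (block-inside (stampOf M s) (suc r′) p (s≤s (subst (_≤ r′) (sym stamp-p) le))))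
        (sym (block-right r′))))

      separated : ∀ {r′} → r′ < r → rel (P r′) left right ≡ false
      separated {r′} lt = ≡ᵇ-false {b r′ left} {b r′ right} λ e → 1+n≢n (sym
        (trans (sym (block-left r′)) (trans e (trans (block-right r′)
          (block-boundary (stampOf M s) (suc r′) p (subst (suc r′ ≤_) (sym stamp-p) lt))))))

    partition-strict : ∀ {r r′} → r < r′ → r′ ≤ K → P r <P P r′
    partition-strict lt le = partition-mono (<⇒≤ lt) ,
      λ ge → contradiction (trans (sym (separated le lt)) (ge (left le) (right le) (joined le ≤-refl))) λ ()

    partition-proper : ∀ {r} → r < K → IsProper (P r)
    partition-proper {r} lt =
      (bottom , (λ ge → left≢right (<⇒≤ lt) (0̂-sound (ge (left (<⇒≤ lt)) (right (<⇒≤ lt)) (joined (<⇒≤ lt) ≤-refl))))) ,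
      ((λ _ _ _ → refl) , λ ge → contradiction (trans (sym (separated ≤-refl lt)) (ge (left ≤-refl) (right ≤-refl) refl)) λ ())
      where
      0̂-sound : ∀ {i j : Fin (suc M)} → rel 0̂ i j ≡ true → i ≡ j
      0̂-sound {i} {j} e with i Fin.≟ j
      ... | yes eq = eq
      0̂-sound () | no _
      bottom : 0̂ ≤P P r
      bottom i j e with 0̂-sound {i} {j} e
      ... | refl = relRefl (P r) i

    cell-chain : ∀ ψ → IsChain (cell ψ π s)
    cell-chain ψ = select-All ψ 0 K (λ r _ lt → partition-proper (subst (r <_) (+-identityʳ K) lt)) ,
      AllPairs⇒Linked (select-AllPairs ψ 0 K
        (λ r r′ lt le → partition-strict lt (<⇒≤ (subst (r′ <_) (+-identityʳ K) le))))

    -- Makes the rank set of a face depend on its orbit only.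
    rank-invariant : ∀ {σ r r′} → r ≤ K → r′ ≤ K → Sends σ (P r) (P r′) → r ≡ r′
    rank-invariant {σ} {r} {r′} le le′ sends = decide (<-cmp r r′)
      where
      same : pairs (P r) ≡ pairs (P r′)
      same = pairs-invariant {σ = σ} {P r} {P r′} sends
      grows : ∀ {i j} → i < j → j ≤ K → pairs (P i) < pairs (P j)
      grows {i} {j} lt j≤ = pairs-mono {u = P i} {P j} (partition-mono (<⇒≤ lt))
        (left j≤) (right j≤) (separated j≤ lt) (joined j≤ ≤-refl)
      decide : Tri (r < r′) (r ≡ r′) (r′ < r) → r ≡ r′
      decide (tri≈ _ e _)  = e
      decide (tri< lt _ _) = contradiction same (<⇒≢ (grows lt le′))
      decide (tri> _ _ gt) = contradiction (sym same) (<⇒≢ (grows gt le))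

    -- This chain has `K` members and none has more, so a chain containing it has the same length.
    facet-maximal : IsMaximalChain (cell always π s)
    facet-maximal = cell-chain always , λ d chain sub → fromPointwise (Pointwise.symmetric (λ { (a , b) → b , a })
      (toPointwise (≤-antisym (length-mono-≤ sub)
         (≤-trans (chain-length chain) (≤-reflexive (sym (length-select-always 0 K))))) sub))

-- Enumerating the facets

-- An element is kept only if no representative chosen from the rest of the list is equivalent to
-- it. This is needed because different placements can give the same word.
transversal : {A : Set} {_~_ : A → A → Set} → (∀ x y → Dec (x ~ y)) →
  (∀ {x} → x ~ x) → (∀ {x y} → x ~ y → y ~ x) → (∀ {x y z} → x ~ y → y ~ z → x ~ z) →
  (xs : List A) → ∃[ m ] Σ (Fin m → A) λ F →
    (∀ {x} → Any (x ~_) xs → ∃[ i ] (x ~ F i)) × (∀ i j → F i ~ F j → i ≡ j)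
transversal _~?_ rfl sy tr [] = 0 , (λ ()) , (λ ()) , (λ ())
transversal {A} {_~_} _~?_ rfl sy tr (x ∷ xs) with transversal _~?_ rfl sy tr xs
... | m , F , complete , distinct with Fin.any? (λ i → x ~? F i)
... | yes (i , xi) = m , F , complete′ , distinct
  where
  complete′ : ∀ {y} → Any (y ~_) (x ∷ xs) → ∃[ i ] (y ~ F i)
  complete′ (here yx)   = i , tr yx xi
  complete′ (there any) = complete any
... | no new = suc m , F′ , complete′ , distinct′
  where
  F′ : Fin (suc m) → A
  F′ zero    = x
  F′ (suc i) = F i
  complete′ : ∀ {y} → Any (y ~_) (x ∷ xs) → ∃[ i ] (y ~ F′ i)
  complete′ (here yx) = zero , yx
  complete′ (there any) with complete any
  ... | i , yi = suc i , yi
  distinct′ : ∀ i j → F′ i ~ F′ j → i ≡ j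
  distinct′ zero    zero    _ = refl
  distinct′ zero    (suc j) e = contradiction (j , e) new
  distinct′ (suc i) zero    e = contradiction (i , sy e) new
  distinct′ (suc i) (suc j) e = cong suc (distinct i j e)

permutations : ∀ n → List (Permutation′ n)
permutations zero    = Perm.id ∷ []
permutations (suc n) = cartesianProductWith (Perm.insert zero) (allFin (suc n)) (permutations n)

permutations-complete : ∀ {n} (π : Permutation′ n) → Any (Perm._≈_ π) (permutations n)
permutations-complete {zero}  π = here (λ ())
permutations-complete {suc n} π = cartesianProductWith⁺ (Perm.insert zero)
  (λ { {ρ} refl p i → trans (sym (Perm.insert-remove zero π i)) (insert-cong p i) })
  (∈-allFin (π ⟨$⟩ʳ zero)) (permutations-complete (Perm.remove zero π))
  where
  insert-cong : ∀ {j} {ρ ρ′ : Permutation′ n} → ρ Perm.≈ ρ′ → Perm.insert zero j ρ Perm.≈ Perm.insert zero j ρ′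
  insert-cong p zero = refl
  insert-cong {j} p (suc i) = cong (punchIn j) (p i)

siblingsSorted? : ∀ M t {_≺_ : ℕ → ℕ → Set} → (∀ a b → Dec (a ≺ b)) → Dec (SiblingsSorted M t _≺_)
siblingsSorted? M t {_≺_} _≺?_ = map′
  (λ h a b a≤b b<M → h b<M (s≤s a≤b)) (λ h {b} b<M {a} a≤b → h a b (≤-pred a≤b) b<M)
  (allUpTo? (λ b → allUpTo? (λ a → opening? a b →-dec (inside? a b →-dec (a ≺? suc b))) (suc b)) M)
  where
  opening? : ∀ a b → Dec (∀ a′ → a ≡ suc a′ → t b ≤ t a′)
  opening? zero    b = yes λ _ ()
  opening? (suc a) b = map′ (λ { le _ refl → le }) (λ h → h a refl) (t b ≤? t a)
  inside? : ∀ a b → Dec (∀ q → a ≤ q → q < b → t q ≤ t b)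
  inside? a b = map′ (λ h q aq qb → h qb aq) (λ h {q} qb aq → h q aq qb)
    (allUpTo? (λ q → (a ≤? q) →-dec (t q ≤? t b)) b)

siblingsSorted-cong : ∀ {M t t′} {_≺_ _≺′_ : ℕ → ℕ → Set} → (∀ p → t p ≡ t′ p) →
  (∀ {a b} → a ≺ b → a ≺′ b) → SiblingsSorted M t _≺_ → SiblingsSorted M t′ _≺′_
siblingsSorted-cong same conv sorted a b a≤b b<M st ins = conv (sorted a b a≤b b<M
  (λ a′ e → subst₂ _≤_ (sym (same b)) (sym (same a′)) (st a′ e))
  (λ q aq qb → subst₂ _≤_ (sym (same q)) (sym (same b)) (ins q aq qb)))

select-Pointwise : ∀ {A B : Set} {R : A → B → Set} {P : ℕ → A} {P′ : ℕ → B} ψ a k →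
  (∀ r → R (P r) (P′ r)) → Pointwise R (select ψ P a k) (select ψ P′ a k)
select-Pointwise ψ a zero h = []
select-Pointwise ψ a (suc k) h with ψ a
... | true  = h a ∷ select-Pointwise ψ (suc a) k h
... | false = select-Pointwise ψ (suc a) k h

-- Ground sets with at most one element

module _ {n : ℕ} (small : ∀ (i j : Fin n) → i ≡ j) (G : Permutation′ n → Set) (G-id : G Perm.id) where

  open Quotient G

  chain-empty : ∀ {x : List (Partition n)} → IsChain x → x ≡ []
  chain-empty {[]} _ = refl
  chain-empty {u ∷ _} (((_ , u≰0̂) , _) ∷ _ , _) = contradiction below u≰0̂
    where
    below : u ≤P 0̂
    below i j _ rewrite small i j = relRefl 0̂ j

  partitionable-small : Partitionable
  partitionable-small = record
    { m = 1 ; F = λ _ → [] ; Gf = λ _ → []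
    ; F-max = λ _ → empty-chain , λ d chain _ → subst (_⊑ []) (sym (chain-empty chain)) []
    ; F-all = λ c max → zero , subst (λ c → OrbEq c []) (sym (chain-empty (proj₁ max))) (Perm.id , G-id , [])
    ; F-distinct = λ { zero zero _ → refl }
    ; G-face = λ _ → empty-chain
    ; G≤F = λ _ → Perm.id , G-id , []
    ; cover = λ x chain → zero , subst (λ c → InInterval [] [] c) (sym (chain-empty chain))
        ((Perm.id , G-id , []) , (Perm.id , G-id , []))
    ; disjoint = λ { x chain zero zero _ _ → refl } }
    where
    empty-chain : IsChain []
    empty-chain = [] , []

-- The partition into intervals

module Partitioning (K : ℕ) (col : Fin (suc (suc K)) → ℕ) where

  open Facets K col
  open Orbits K col

  private
    M : ℕ
    M = suc K

  Young : Perm → Set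
  Young σ = ∀ e → col (σ ⟨$⟩ʳ e) ≡ col e

  open Quotient Young

  young-inverse : ∀ {σ} → Young σ → Young (flip σ)
  young-inverse {σ} y e = trans (sym (y (σ ⟨$⟩ˡ e))) (cong col (inverseʳ σ))

  sameWord? : ∀ F F′ → Dec (SameWord F F′)
  sameWord? F F′ = map′ (λ h p p≤ → h (s≤s p≤)) (λ h {p} p< → h p (≤-pred p<))
    (allUpTo? (λ p → (colours (Facet.π F) p ≟ colours (Facet.π F′) p) ×-dec
                     (stampOf M (Facet.s F) p ≟ stampOf M (Facet.s F′) p)) (suc M))

  Sorted : Perm → Perm → Set
  Sorted π s = SiblingsSorted M (stampOf M s) (Precedes (colours π) (stampOf M s))

  sorted? : ∀ π s → Dec (Sorted π s)
  sorted? π s = siblingsSorted? M (stampOf M s) (precedes? (colours π) (stampOf M s))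

  facetsOf : ∀ π s → Dec (stampOf M s M ≡ M) → Dec (Sorted π s) → List Facet
  facetsOf π s (yes e) (yes h) = record { π = π ; s = s ; s-last = e ; sorted = h } ∷ []
  facetsOf π s (yes _) (no _)  = []
  facetsOf π s (no _)  _       = []

  facets : List Facet
  facets = concat (cartesianProductWith (λ π s → facetsOf π s (stampOf M s M ≟ M) (sorted? π s))
                    (permutations (suc M)) (permutations (suc M)))

  facets-complete : ∀ F → Any (SameWord F) facets
  facets-complete F = concat⁺ (cartesianProductWith⁺ _ (λ {π′} {s′} → found π′ s′)
    (permutations-complete (Facet.π F)) (permutations-complete (Facet.s F)))
    where
    open Facet F
    found : ∀ π′ s′ → π Perm.≈ π′ → s Perm.≈ s′ →
            Any (SameWord F) (facetsOf π′ s′ (stampOf M s′ M ≟ M) (sorted? π′ s′))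
    found π′ s′ π≈ s≈ = decide (stampOf M s′ M ≟ M) (sorted? π′ s′)
      where
      c≡ : ∀ p → colours π p ≡ colours π′ p
      c≡ p = cong col (element-cong M {π} {π′} π≈ p)
      s≡ : ∀ p → stampOf M s p ≡ stampOf M s′ p
      s≡ = stampOf-cong M {s} {s′} s≈
      conv : ∀ {a b} → Precedes (colours π) (stampOf M s) a b → Precedes (colours π′) (stampOf M s′) a b
      conv {a} {b} (inj₁ lt) = inj₁ (subst₂ _<_ (c≡ b) (c≡ a) lt)
      conv {a} {b} (inj₂ (e , lt)) =
        inj₂ (trans (sym (c≡ a)) (trans e (c≡ b)) , subst₂ _<_ (s≡ a) (s≡ b) lt)
      decide : (d : Dec (stampOf M s′ M ≡ M)) (d′ : Dec (Sorted π′ s′)) → Any (SameWord F) (facetsOf π′ s′ d d′)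
      decide (yes _) (yes _) = here (λ p _ → c≡ p , s≡ p)
      decide (yes _) (no ¬h) = contradiction (siblingsSorted-cong s≡ (λ {a} {b} → conv {a} {b}) sorted) ¬h
      decide (no ¬e) _       = contradiction (trans (sym (s≡ M)) s-last) ¬e

  module Transport (F₀ F : Facet) (same : SameWord F₀ F) where

    open Facet F₀ renaming (π to π₀; s to s₀; s-last to s₀-last; sorted to sorted₀)
    open Facet F

    -- Moves the element at a position of `F₀` to the element at the same position of `F`. Equal
    -- colours place it in the Young subgroup.
    σ : Perm
    σ = π₀ ∘ₚ flip π

    position-σ : ∀ e → position M π (σ ⟨$⟩ʳ e) ≡ position M π₀ e
    position-σ e = cong toℕ (inverseʳ π)

    young : Young σ
    young e = trans (sym (colours-position π (σ ⟨$⟩ʳ e)))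
      (trans (cong (colours π) (position-σ e))
        (trans (sym (proj₁ (same _ (position-bound M π₀ e)))) (colours-position π₀ e)))

    sends : ∀ r → Sends σ (partitionAt π₀ s₀ r) (partitionAt π s r)
    sends r e f = cong₂ _≡ᵇ_ (block≡ e) (block≡ f)
      where
      block≡ : ∀ e → block (stampOf M s) (suc r) (position M π (σ ⟨$⟩ʳ e)) ≡
                     block (stampOf M s₀) (suc r) (position M π₀ e)
      block≡ e = trans (cong (block (stampOf M s) (suc r)) (position-σ e))
        (block-cong (position M π₀ e) (λ q lt → cong (_<ᵇ suc r)
          (sym (proj₂ (same q (<⇒≤ (<-≤-trans lt (position-bound M π₀ e))))))))

    place≡ : ∀ {r} → r ≤ M → placeOf M s₀ r ≡ placeOf M s r
    place≡ {r} r≤ = stampOf-injective M s (placeOf-≤ M s₀ r) (placeOf-≤ M s r)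
      (trans (sym (proj₂ (same _ (placeOf-≤ M s₀ r)))) (trans (stamp-place M s₀ r≤) (sym (stamp-place M s r≤))))

    descent≡ : ∀ {r} → r < K → descent π₀ s₀ r ≡ false → descent π s r ≡ false
    descent≡ {r} r< e = precedes⇒no-descent π s
      (subst₂ (λ a b → Precedes (colours π) (stampOf M s) (suc a) (suc b))
        (place≡ (m≤n⇒m≤1+n (<⇒≤ r<))) (place≡ (m≤n⇒m≤1+n r<)) (conv (no-descent π₀ s₀ e)))
      where
      open Stamps s₀ s₀-last
      a b : ℕ
      a = suc (placeOf M s₀ r)
      b = suc (placeOf M s₀ (suc r))
      a≤ : a ≤ M
      a≤ = place-inner (<⇒≤ r<)
      b≤ : b ≤ M
      b≤ = place-inner r<
      conv : Precedes (colours π₀) (stampOf M s₀) a b → Precedes (colours π) (stampOf M s) a b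
      conv (inj₁ lt) = inj₁ (subst₂ _<_ (proj₁ (same b b≤)) (proj₁ (same a a≤)) lt)
      conv (inj₂ (eq , lt)) = inj₂
        ( trans (sym (proj₁ (same a a≤))) (trans eq (proj₁ (same b b≤)))
        , subst₂ _<_ (proj₂ (same a a≤)) (proj₂ (same b b≤)) lt)

    transport : ∀ {x ψ} → Matches x π₀ s₀ Perm.id ψ → Matches x π s σ ψ
    transport {x} {ψ} m = record
      { ψ-top = Matches.ψ-top m
      ; descent⊆ψ = descends
      ; pointwise = Pointwise.transitive {R = Sends Perm.id} {S = Sends σ} {T = Sends σ}
          (λ uv vw e f → trans (vw e f) (uv e f))
          (Matches.pointwise m) (select-Pointwise {R = Sends σ} ψ 0 K sends) }
      where
      descends : ∀ r → r < K → descent π s r ≡ true → ψ r ≡ true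
      descends r r< d with descent π₀ s₀ r in d₀
      ... | true  = Matches.descent⊆ψ m r r< d₀
      ... | false = contradiction (trans (sym d) (descent≡ r< d₀)) λ ()

  matches⇒interval : ∀ {x π s σ ψ} → Young σ → Matches x π s σ ψ →
                     InInterval (cell (descent π s) π s) (cell always π s) x
  matches⇒interval {x} {π} {s} {σ} {ψ} y m =
    (flip σ , young-inverse {σ} y ,
      select-restrict (descent π s) ψ 0 K
        (λ r lt → Matches.descent⊆ψ m r (subst (r <_) (+-identityʳ K) lt))
        (λ {u} {v} → sends-inverse {σ = σ} {u} {v}) (Matches.pointwise m)) ,
    (σ , y , select-Sublist ψ 0 K (Matches.pointwise m))

  -- The upper bound supplies `σ` and `ψ`. A descent is a rank of the bottom, so the composite of
  -- the two permutations carries its partition to one selected by `ψ`, which by `rank-invariant`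
  -- has the same rank.
  interval⇒matches : ∀ (F : Facet) {x} → let open Facet F in
    InInterval (cell (descent π s) π s) (cell always π s) x →
    ∃[ σ ] ∃[ ψ ] (Young σ × Matches x π s σ ψ)
  interval⇒matches F {x} ((σ′ , _ , sub′) , (σ , y , sub)) = build (Sublist⇒select 0 K sub)
    where
    open Facet F
    P : ℕ → Partition (suc M)
    P = partitionAt π s
    build : ∃[ ψ ] (ψ (K + 0) ≡ true × Pointwise (Sends σ) x (select ψ P 0 K)) →
            ∃[ σ ] ∃[ ψ ] (Young σ × Matches x π s σ ψ)
    build (ψ , ψt , pw) = σ , ψ , y , record
      { ψ-top = subst (λ r → ψ r ≡ true) (+-identityʳ K) ψt ; descent⊆ψ = descends ; pointwise = pw }
      where
      descends : ∀ r → r < K → descent π s r ≡ true → ψ r ≡ true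
      descends r r< d = conclude (select-Any⁻ ψ 0 K
        (lookup {P = Sends σ′ (P r)} {Q = Sends (σ′ ∘ₚ σ) (P r)}
          (λ uv pu i j → trans (uv (σ′ ⟨$⟩ʳ i) (σ′ ⟨$⟩ʳ j)) (pu i j)) (fromPointwise pw)
          (lookup {P = _≡ P r} {Q = Sends σ′ (P r)} (λ { uv refl → uv }) sub′
            (select-Any⁺ (descent π s) 0 K z≤n (subst (r <_) (sym (+-identityʳ K)) r<) d refl))))
        where
        conclude : ∃[ r′ ] (r′ < K + 0 × ψ r′ ≡ true × Sends (σ′ ∘ₚ σ) (P r) (P r′)) → ψ r ≡ true
        conclude (r′ , lt , ψr′ , sends) = subst (λ z → ψ z ≡ true)
          (sym (rank-invariant π s s-last {σ′ ∘ₚ σ} (<⇒≤ r<) (<⇒≤ (subst (r′ <_) (+-identityʳ K) lt)) sends)) ψr′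

  whole-matches : ∀ {x π s σ} → Pointwise (Sends σ) x (cell always π s) → Matches x π s σ always
  whole-matches pw = record { ψ-top = refl ; descent⊆ψ = λ _ _ _ → refl ; pointwise = pw }

  partitionable : Partitionable
  partitionable = build (transversal sameWord? (λ _ _ → refl , refl)
      (λ h p p≤ → sym (proj₁ (h p p≤)) , sym (proj₂ (h p p≤)))
      (λ h h′ p p≤ → trans (proj₁ (h p p≤)) (proj₁ (h′ p p≤)) , trans (proj₂ (h p p≤)) (proj₂ (h′ p p≤)))
      facets)
    where
    build : ∃[ m ] Σ (Fin m → Facet) (λ F →
      (∀ {x} → Any (SameWord x) facets → ∃[ i ] SameWord x (F i)) × (∀ i j → SameWord (F i) (F j) → i ≡ j)) →
      Partitionable
    build (m , F , complete , distinct) = record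
      { m = m ; F = top ; Gf = bottom
      ; F-max = λ t → facet-maximal (π t) (s t) (s-last t)
      ; F-all = covers-maximal
      -- A facet is a face of itself with all ranks selected, so this is uniqueness for the chain
      -- `top t`.
      ; F-distinct = λ { t t′ (σ , y , pw) → distinct t t′ (matches-unique (F t) (F t′) Perm.id σ
          (λ _ → refl) y (whole-matches (Pointwise.refl (λ _ _ → refl))) (whole-matches pw)) }
      ; G-face = λ t → cell-chain (π t) (s t) (s-last t) (descent (π t) (s t))
      ; G≤F = λ t → Perm.id , (λ _ → refl) ,
          select-restrict (descent (π t) (s t)) always 0 K (λ _ _ _ → refl) (λ {u} {v} h i j → sym (h i j))
            (Pointwise.refl {R = Sends Perm.id} (λ _ _ → refl))
      ; cover = λ x chain → let t , σ , ψ , y , m = covered chain in t , matches⇒interval y m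
      ; disjoint = λ x chain t t′ I I′ →
          let σ , ψ , y , m = interval⇒matches (F t) I
              σ′ , ψ′ , y′ , m′ = interval⇒matches (F t′) I′
          in distinct t t′ (matches-unique (F t) (F t′) σ σ′ y y′ m m′) }
      where
      π s : Fin m → Perm
      π t = Facet.π (F t)
      s t = Facet.s (F t)
      s-last : ∀ t → stampOf M (s t) M ≡ M
      s-last t = Facet.s-last (F t)
      top bottom : Fin m → List (Partition (suc M))
      top t    = cell always (π t) (s t)
      bottom t = cell (descent (π t) (s t)) (π t) (s t)

      covered : ∀ {x} → IsChain x → ∃[ t ] ∃[ σ ] ∃[ ψ ] (Young σ × Matches x (π t) (s t) σ ψ)
      covered {x} chain = t , T.σ , Cover.ψ chain , T.young , T.transport (Cover.matches chain)
        where
        found : ∃[ i ] SameWord (Cover.facet chain) (F i)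
        found = complete {Cover.facet chain} (facets-complete (Cover.facet chain))
        t : Fin m
        t = proj₁ found
        module T = Transport (Cover.facet chain) (F t) (proj₂ found)

      covers-maximal : ∀ x → IsMaximalChain x → ∃[ t ] OrbEq x (top t)
      covers-maximal x (chain , maximal) = conclude (covered chain)
        where
        F₀ : Facet
        F₀ = Cover.facet chain
        above : x ⊑ cell always (Facet.π F₀) (Facet.s F₀)
        above = select-Sublist (Cover.ψ chain) 0 K
          (Pointwise.map (λ {u} {v} → sends-id⇒≈ {u = u} {v}) (Matches.pointwise (Cover.matches chain)))
        -- A maximal chain lies in the facet that standardisation puts above it, and so has as many
        -- members.
        full : length x ≡ K
        full = ≤-antisym (chain-length chain) (subst (_≤ length x) (length-select-always 0 K)
          (length-mono-≤ (maximal _ (cell-chain (Facet.π F₀) (Facet.s F₀) (Facet.s-last F₀) always) above)))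
        conclude : ∃[ t ] ∃[ σ ] ∃[ ψ ] (Young σ × Matches x (π t) (s t) σ ψ) → ∃[ t ] OrbEq x (top t)
        conclude (t , σ , ψ , y , m) = t , σ , y ,
          toPointwise (trans full (sym (length-select-always 0 K))) (select-Sublist ψ 0 K (Matches.pointwise m))

theorem4p4 : (n : ℕ) (λs : List ℕ) → IsComposition n λs →
    Quotient.Partitionable {n} (InYoung λs)
theorem4p4 zero          λs _ = partitionable-small (λ ()) (InYoung λs) (λ _ → refl)
theorem4p4 (suc zero)    λs _ = partitionable-small (λ { zero zero → refl }) (InYoung λs) (λ _ → refl)
-- From two elements on `0̂ <P 1̂` holds, so even the empty chain has an arrangement. The colours
-- are the indices of the Young factors.
theorem4p4 (suc (suc K)) λs _ = Partitioning.partitionable K (λ e → blockOf λs (toℕ e))
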